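{- Let $n\geq 0$. Every strictly convex polygon with $2n+2$ vertices has exactly $\binom{2n}{n}^2\frac{1}{n+1}$ fair triangulations.
   Context: A triangulation of a strictly convex polygon is a decomposition of it into non-overlapping triangles whose vertices are vertices of the polygon (a polygon with $m+2$ vertices is decomposed into $m$ triangles). A checkerboard colouring of a triangulation colours every triangle black or white so that triangles sharing an edge have different colours; such a colouring exists and is unique up to exchanging the two colours. A triangulation is called fair if its checkerboard colourings involve the same number of black and white triangles. -}

module Defs where

open import Data.Nat using (ℕ; zero; suc; _+_; _*_; _∸_; _≤_; _<_)
open import Data.Fin using (Fin; toℕ)
open import Data.Bool using (Bool; true; false)
open import Data.Vec using (Vec; lookup)
open import Data.List using (List; []; _∷_)
open import Data.Product using (Σ; _×_; _,_)
open import Data.Sum using (_⊎_)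
open import Relation.Binary.PropositionalEquality using (_≡_; _≢_)

-- Vertices of a strictly convex polygon with N vertices are labelled by
-- Fin N in cyclic (say counter-clockwise) order.  Since the polygon is
-- strictly convex, all geometric incidences between triangles spanned by
-- its vertices depend only on this cyclic order.

-- A triangle spanned by polygon vertices: a triple (a , b , c), meant with
-- toℕ a < toℕ b < toℕ c (enforced for members of a triangle set below).
Tri : ℕ → Set
Tri N = Fin N × Fin N × Fin N

-- A set of triangles: characteristic cube (an extensional finite set).
TriSet : ℕ → Set
TriSet N = Vec (Vec (Vec Bool N) N) N

memᵇ : ∀ {N} → TriSet N → Tri N → Bool
memᵇ S (a , b , c) = lookup (lookup (lookup S a) b) c

_∈T_ : ∀ {N} → Tri N → TriSet N → Set
t ∈T S = memᵇ S t ≡ true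

Ordered : ∀ {N} → Tri N → Set
Ordered (a , b , c) = toℕ a < toℕ b × toℕ b < toℕ c

VertexOf : ∀ {N} → Fin N → Tri N → Set
VertexOf x (a , b , c) = x ≡ a ⊎ x ≡ b ⊎ x ≡ c

-- x lies on one of the three closed boundary arcs of the polygon cut off by
-- the sides of the (ordered) triangle (a , b , c): [a,b], [b,c], [c,a].
InArcAB InArcBC InArcCA : ∀ {N} → Tri N → Fin N → Set
InArcAB (a , b , c) x = toℕ a ≤ toℕ x × toℕ x ≤ toℕ b
InArcBC (a , b , c) x = toℕ b ≤ toℕ x × toℕ x ≤ toℕ c
InArcCA (a , b , c) x = toℕ c ≤ toℕ x ⊎ toℕ x ≤ toℕ a

AllIn : ∀ {N} → (Fin N → Set) → Tri N → Set
AllIn P (d , e , f) = P d × P e × P f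

-- Two triangles with vertices in convex position have disjoint interiors
-- iff all vertices of the second lie on one closed arc cut off by a side
-- of the first.
InteriorDisjoint : ∀ {N} → Tri N → Tri N → Set
InteriorDisjoint t t' =
  AllIn (InArcAB t) t' ⊎ AllIn (InArcBC t) t' ⊎ AllIn (InArcCA t) t'

countᵇ : ∀ {A : Set} → (A → Bool) → List A → ℕ
countᵇ p [] = 0
countᵇ p (x ∷ xs) with p x
... | true  = suc (countᵇ p xs)
... | false = countᵇ p xs

allFinL : (N : ℕ) → List (Fin N)
allFinL N = Data.List.allFin N
  where import Data.List

allTris : (N : ℕ) → List (Tri N)
allTris N = concatMap (λ a → concatMap (λ b → map (λ c → (a , b , c)) (allFinL N)) (allFinL N)) (allFinL N)
  where open import Data.List using (concatMap; map)

size : ∀ {N} → TriSet N → ℕ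
size {N} S = countᵇ (memᵇ S) (allTris N)

record IsTriangulation {N : ℕ} (S : TriSet N) : Set where
  field
    ordered  : ∀ t → t ∈T S → Ordered t
    disjoint : ∀ t t' → t ∈T S → t' ∈T S → t ≢ t' → InteriorDisjoint t t'
    card     : size S ≡ N ∸ 2

-- Two distinct triangles of a triangulation share an edge iff they have two
-- distinct common vertices (the segment between them is then a common side).
ShareEdge : ∀ {N} → Tri N → Tri N → Set
ShareEdge t t' = Σ _ λ x → Σ _ λ y →
  x ≢ y × VertexOf x t × VertexOf y t × VertexOf x t' × VertexOf y t'

IsCheckerboard : ∀ {N} → TriSet N → (Tri N → Bool) → Set
IsCheckerboard S col = ∀ t t' → t ∈T S → t' ∈T S → t ≢ t' →
  ShareEdge t t' → col t ≢ col t'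

and : Bool → Bool → Bool
and true b = b
and false _ = false

not : Bool → Bool
not true = false
not false = true

blackCount whiteCount : ∀ {N} → TriSet N → (Tri N → Bool) → ℕ
blackCount {N} S col = countᵇ (λ t → and (memᵇ S t) (col t)) (allTris N)
whiteCount {N} S col = countᵇ (λ t → and (memᵇ S t) (not (col t))) (allTris N)

-- Fair: its checkerboard colouring has as many black as white triangles
-- (the colouring is unique up to swapping colours, so "some" = "every").
Fair : ∀ {N} → TriSet N → Set
Fair S = Σ _ λ col → IsCheckerboard S col × blackCount S col ≡ whiteCount S col

{-# OPTIONS --safe #-}

-- A triangle (a , b , c) with a < b < c is determined, within a triangulation, by its middle
-- vertex b, and N − 2 non-overlapping triangles realise every b with 0 < b < N − 1.  Hence
-- triangulations are binary trees, the root being the triangle on the side {0 , N − 1}, and the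
-- checkerboard colour of a triangle is the parity of its depth.
--
-- Let F and G count binary trees by x^(nodes of even depth) y^(nodes of odd depth), with the root
-- at even resp. odd depth, so F = 1 + x G² and G = 1 + y F².  Lagrange inversion gives the
-- coefficient of x^p y^q in F^s G^t as
--   C(s+2q, p) C(t+2p, q) − 4 C(s+2q−1, p−1) C(t+2p−1, q−1).
-- Here the formula is checked through the recurrence F^(s+1) G^t = F^s G^t + x F^s G^(t+2) and
-- its mirror image, which both products satisfy separately by Pascal's rule.
module Submission where

open import Defs
open import Data.Bool as Bool using (Bool; true; false)
open import Data.Fin using (Fin; toℕ)
open import Data.Fin.Properties using (toℕ-injective; toℕ-fromℕ<; toℕ<n)
open import Data.List using (List; []; _∷_; _++_; map; length; filter; concatMap; upTo)
open import Data.List.Properties using (length-++; length-map; length-upTo)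
open import Data.List.Membership.Propositional using (_∈_; _∉_; find; lose)
open import Data.List.Membership.Propositional.Properties using
  (∈-++⁺ˡ; ∈-++⁺ʳ; ∈-++⁻; ∈-∃++; ∈-map⁺; ∈-map⁻; ∈-filter⁺; ∈-filter⁻; ∈-concatMap⁺; ∈-concatMap⁻; ∈-allFin; ∈-upTo⁺)
import Data.List.Membership.DecPropositional as DecMembership
open import Data.List.Relation.Unary.All as All using (All; []; _∷_)
import Data.List.Relation.Unary.All.Properties as All
open import Data.List.Relation.Unary.AllPairs using ([]; _∷_)
open import Data.List.Relation.Unary.Any using (here; there; satisfied)
open import Data.List.Relation.Unary.Unique.Propositional using (Unique)
import Data.List.Relation.Unary.Unique.Propositional.Properties as Unique
open import Data.Nat using (ℕ; zero; suc; _+_; _*_; _/_; _≤_; _<_; z≤n; s≤s; s≤s⁻¹)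
open import Data.Nat.Combinatorics using (_C_; nCk+nC[k+1]≡[n+1]C[k+1])
open import Data.Nat.DivMod using (_mod_; m%n<n; m<n⇒m%n≡m; m*n/n≡m)
open import Data.Nat.Properties
open import Data.Nat.Tactic.RingSolver using (solve-∀)
open import Data.Product using (Σ; ∃; ∃₂; _×_; _,_; proj₁; proj₂)
open import Data.Product.Properties using (≡-dec)
open import Data.Sum as Sum using (_⊎_; inj₁; inj₂)
open import Data.Vec using (Vec; []; _∷_; lookup; tabulate)
open import Data.Vec.Properties using (lookup∘tabulate; tabulate∘lookup; tabulate-cong)
open import Function using (_∘_; id)
open import Function.Bundles using (_⇔_; mk⇔)
open import Function.Definitions using (Injective)
open import Relation.Binary.Definitions using (DecidableEquality; tri<; tri≈; tri>)
open import Relation.Binary.PropositionalEquality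
open import Relation.Nullary using (¬_; does; yes; no; contradiction)
open import Relation.Nullary.Decidable using (decidable-stable; dec-true)

-- Binary trees by parity of depth

data Tree : Set where
  leaf : Tree
  node : Tree → Tree → Tree

evens odds : Tree → ℕ
evens leaf = 0
evens (node l r) = suc (odds l + odds r)
odds leaf = 0
odds (node l r) = evens l + evens r

-- s trees rooted at even depth and t trees rooted at odd depth, the coefficients of F^s G^t.
Forest : ℕ → ℕ → Set
Forest s t = Vec Tree s × Vec Tree t

evenSum oddSum : ∀ {n} → Vec Tree n → ℕ
evenSum [] = 0
evenSum (x ∷ xs) = evens x + evenSum xs
oddSum [] = 0
oddSum (x ∷ xs) = odds x + oddSum xs

evensF oddsF : ∀ {s t} → Forest s t → ℕ
evensF (es , os) = evenSum es + oddSum os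
oddsF (es , os) = oddSum es + evenSum os

leafˡ : ∀ {s t} → Forest s t → Forest (suc s) t
leafˡ (es , os) = leaf ∷ es , os

leafʳ : ∀ {s t} → Forest s t → Forest s (suc t)
leafʳ (es , os) = es , leaf ∷ os

nodeˡ : ∀ {s t} → Forest s (2 + t) → Forest (suc s) t
nodeˡ (es , l ∷ r ∷ os) = node l r ∷ es , os

nodeʳ : ∀ {s t} → Forest (2 + s) t → Forest s (suc t)
nodeʳ (l ∷ r ∷ es , os) = es , node l r ∷ os

-- The first tree is expanded: F^(s+1) G^t = F^s G^t + x F^s G^(t+2) and, once no even-rooted tree
-- is left, G^(t+1) = G^t + y F² G^t. Every call either drops a leaf or spends one of the `p + q`
-- nodes.
forests : ∀ s t → ℕ → ℕ → List (Forest s t)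
forests zero    zero    zero    zero    = ([] , []) ∷ []
forests zero    zero    zero    (suc q) = []
forests zero    zero    (suc p) q       = []
forests zero    (suc t) p       zero    = map leafʳ (forests zero t p zero)
forests zero    (suc t) p       (suc q) = map leafʳ (forests zero t p (suc q)) ++ map nodeʳ (forests 2 t p q)
forests (suc s) t       zero    q       = map leafˡ (forests s t zero q)
forests (suc s) t       (suc p) q       = map leafˡ (forests s t (suc p) q) ++ map nodeˡ (forests s (2 + t) p q)

evensF-nodeˡ : ∀ {s t} (f : Forest s (2 + t)) → evensF (nodeˡ f) ≡ suc (evensF f)
evensF-nodeˡ (es , l ∷ r ∷ os) = lemma (odds l) (odds r) (evenSum es) (oddSum os)
  where
  lemma : ∀ a b c d → suc (a + b) + c + d ≡ suc (c + (a + (b + d)))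
  lemma = solve-∀

oddsF-nodeˡ : ∀ {s t} (f : Forest s (2 + t)) → oddsF (nodeˡ f) ≡ oddsF f
oddsF-nodeˡ (es , l ∷ r ∷ os) = lemma (evens l) (evens r) (oddSum es) (evenSum os)
  where
  lemma : ∀ a b c d → a + b + c + d ≡ c + (a + (b + d))
  lemma = solve-∀

evensF-nodeʳ : ∀ {s t} (f : Forest (2 + s) t) → evensF (nodeʳ f) ≡ evensF f
evensF-nodeʳ (l ∷ r ∷ es , os) = lemma (evens l) (evens r) (evenSum es) (oddSum os)
  where
  lemma : ∀ a b c d → c + (a + b + d) ≡ a + (b + c) + d
  lemma = solve-∀

oddsF-nodeʳ : ∀ {s t} (f : Forest (2 + s) t) → oddsF (nodeʳ f) ≡ suc (oddsF f)
oddsF-nodeʳ (l ∷ r ∷ es , os) = lemma (odds l) (odds r) (oddSum es) (evenSum os)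
  where
  lemma : ∀ a b c d → c + suc (a + b + d) ≡ suc (a + (b + c) + d)
  lemma = solve-∀

HasCounts : ∀ {s t} → Forest s t → ℕ → ℕ → Set
HasCounts f p q = evensF f ≡ p × oddsF f ≡ q

nodeˡ-counts : ∀ {s t p q} (f : Forest s (2 + t)) → HasCounts f p q → HasCounts (nodeˡ f) (suc p) q
nodeˡ-counts f (eq , eq′) = trans (evensF-nodeˡ f) (cong suc eq) , trans (oddsF-nodeˡ f) eq′

nodeʳ-counts : ∀ {s t p q} (f : Forest (2 + s) t) → HasCounts f p q → HasCounts (nodeʳ f) p (suc q)
nodeʳ-counts f (eq , eq′) = trans (evensF-nodeʳ f) eq , trans (oddsF-nodeʳ f) (cong suc eq′)

forests-sound : ∀ s t p q → All (λ f → HasCounts f p q) (forests s t p q)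
forests-sound zero    zero    zero    zero    = (refl , refl) ∷ []
forests-sound zero    zero    zero    (suc q) = []
forests-sound zero    zero    (suc p) q       = []
-- A leaf adds 0 to both counts by computation, so `All.map id` only retypes the predicate.
forests-sound zero    (suc t) p       zero    = All.map⁺ (All.map id (forests-sound zero t p zero))
forests-sound zero    (suc t) p       (suc q) =
  All.++⁺ (All.map⁺ (All.map id (forests-sound zero t p (suc q))))
          (All.map⁺ (All.map (λ {f} → nodeʳ-counts f) (forests-sound 2 t p q)))
forests-sound (suc s) t       zero    q       = All.map⁺ (All.map id (forests-sound s t zero q))
forests-sound (suc s) t       (suc p) q       =
  All.++⁺ (All.map⁺ (All.map id (forests-sound s t (suc p) q)))
          (All.map⁺ (All.map (λ {f} → nodeˡ-counts f) (forests-sound s (2 + t) p q)))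

forests-complete : ∀ s t p q f → HasCounts f p q → f ∈ forests s t p q
forests-complete zero zero zero zero ([] , []) _ = here refl
forests-complete zero (suc t) p zero ([] , leaf ∷ os) h =
  ∈-map⁺ leafʳ (forests-complete zero t p zero ([] , os) h)
forests-complete zero (suc t) p (suc q) ([] , leaf ∷ os) h =
  ∈-++⁺ˡ (∈-map⁺ leafʳ (forests-complete zero t p (suc q) ([] , os) h))
forests-complete zero (suc t) p (suc q) ([] , node l r ∷ os) (eq , eq′) =
  ∈-++⁺ʳ (map leafʳ (forests zero t p (suc q))) (∈-map⁺ nodeʳ (forests-complete 2 t p q f
    ( trans (sym (evensF-nodeʳ f)) eq
    , suc-injective (trans (sym (oddsF-nodeʳ f)) eq′))))
  where f = l ∷ r ∷ [] , os
forests-complete (suc s) t zero q (leaf ∷ es , os) h =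
  ∈-map⁺ leafˡ (forests-complete s t zero q (es , os) h)
forests-complete (suc s) t (suc p) q (leaf ∷ es , os) h =
  ∈-++⁺ˡ (∈-map⁺ leafˡ (forests-complete s t (suc p) q (es , os) h))
forests-complete (suc s) t (suc p) q (node l r ∷ es , os) (eq , eq′) =
  ∈-++⁺ʳ (map leafˡ (forests s t (suc p) q)) (∈-map⁺ nodeˡ (forests-complete s (2 + t) p q f
    ( suc-injective (trans (sym (evensF-nodeˡ f)) eq)
    , trans (sym (oddsF-nodeˡ f)) eq′)))
  where f = es , l ∷ r ∷ os

leafˡ-injective : ∀ {s t} {f g : Forest s t} → leafˡ f ≡ leafˡ g → f ≡ g
leafˡ-injective refl = refl

leafʳ-injective : ∀ {s t} {f g : Forest s t} → leafʳ f ≡ leafʳ g → f ≡ g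
leafʳ-injective refl = refl

nodeˡ-injective : ∀ {s t} {f g : Forest s (2 + t)} → nodeˡ f ≡ nodeˡ g → f ≡ g
nodeˡ-injective {f = _ , _ ∷ _ ∷ _} {g = _ , _ ∷ _ ∷ _} refl = refl

nodeʳ-injective : ∀ {s t} {f g : Forest (2 + s) t} → nodeʳ f ≡ nodeʳ g → f ≡ g
nodeʳ-injective {f = _ ∷ _ ∷ _ , _} {g = _ ∷ _ ∷ _ , _} refl = refl

leafˡ≢nodeˡ : ∀ {s t} (f : Forest s t) (g : Forest s (2 + t)) → leafˡ f ≢ nodeˡ g
leafˡ≢nodeˡ f (_ , _ ∷ _ ∷ _) ()

leafʳ≢nodeʳ : ∀ {s t} (f : Forest s t) (g : Forest (2 + s) t) → leafʳ f ≢ nodeʳ g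
leafʳ≢nodeʳ f (_ ∷ _ ∷ _ , _) ()

map-++-unique : ∀ {A B C : Set} {f : A → C} {g : B → C} {xs ys} →
  (∀ {x y} → f x ≡ f y → x ≡ y) → (∀ {x y} → g x ≡ g y → x ≡ y) → (∀ x y → f x ≢ g y) →
  Unique xs → Unique ys → Unique (map f xs ++ map g ys)
map-++-unique {f = f} {g} f-inj g-inj f≢g uxs uys =
  Unique.++⁺ (Unique.map⁺ f-inj uxs) (Unique.map⁺ g-inj uys) λ (z∈ , z∈′) →
    let x , _ , eq = ∈-map⁻ f z∈
        y , _ , eq′ = ∈-map⁻ g z∈′
    in f≢g x y (trans (sym eq) eq′)

forests-unique : ∀ s t p q → Unique (forests s t p q)
forests-unique zero zero zero zero = [] ∷ []
forests-unique zero zero zero (suc q) = []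
forests-unique zero zero (suc p) q = []
forests-unique zero (suc t) p zero = Unique.map⁺ leafʳ-injective (forests-unique zero t p zero)
forests-unique zero (suc t) p (suc q) =
  map-++-unique leafʳ-injective nodeʳ-injective leafʳ≢nodeʳ
    (forests-unique zero t p (suc q)) (forests-unique 2 t p q)
forests-unique (suc s) t zero q = Unique.map⁺ leafˡ-injective (forests-unique s t zero q)
forests-unique (suc s) t (suc p) q =
  map-++-unique leafˡ-injective nodeˡ-injective leafˡ≢nodeˡ
    (forests-unique s t (suc p) q) (forests-unique s (2 + t) p q)

-- Binomial identities and the recurrences of the two products

nC0≡1 : ∀ n → n C 0 ≡ 1
nC0≡1 zero = refl
nC0≡1 (suc n) = refl

pascal : ∀ n k → suc n C suc k ≡ n C k + n C suc k
pascal n k = sym (nCk+nC[k+1]≡[n+1]C[k+1] n k)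

-- Induction on `n` by Pascal's rule: one copy of the middle binomial `X` is set aside, and the rest
-- falls to the induction hypotheses at `k` and `suc k`.
absorption : ∀ n k → suc k * (suc n C suc k) ≡ suc n * (n C k)
absorption zero    zero    = refl
absorption zero    (suc k) = *-zeroʳ (2 + k)
absorption (suc n) zero    = begin
  1 * ((2 + n) C 1)              ≡⟨ cong (1 *_) (pascal (suc n) 0) ⟩
  1 * (suc n C 0 + suc n C 1)  ≡⟨ lemma (suc n C 0) (suc n C 1) ⟩
  suc n C 0 + 1 * (suc n C 1)  ≡⟨ cong₂ _+_ (nC0≡1 (suc n)) (absorption n 0) ⟩
  1 + suc n * (n C 0)          ≡⟨ cong (λ x → 1 + suc n * x) (nC0≡1 n) ⟩
  (2 + n) * 1                  ≡⟨ cong ((2 + n) *_) (nC0≡1 (suc n)) ⟨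
  (2 + n) * (suc n C 0)        ∎
  where
  open ≡-Reasoning
  lemma : ∀ a b → 1 * (a + b) ≡ a + 1 * b
  lemma = solve-∀
absorption (suc n) (suc k) = begin
  (2 + k) * ((2 + n) C (2 + k))                       ≡⟨ cong ((2 + k) *_) (pascal (suc n) (suc k)) ⟩
  (2 + k) * (X + Y)                               ≡⟨ lemma (suc k) X Y ⟩
  X + (suc k * X + (2 + k) * Y)                   ≡⟨ cong (X +_) (cong₂ _+_ (absorption n k) (absorption n (suc k))) ⟩
  X + (suc n * (n C k) + suc n * (n C suc k))     ≡⟨ lemma′ X (suc n) (n C k) (n C suc k) ⟩
  X + suc n * (n C k + n C suc k)                 ≡⟨ cong (λ x → X + suc n * x) (pascal n k) ⟨
  (2 + n) * X                                     ∎
  where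
  open ≡-Reasoning
  X = suc n C suc k
  Y = suc n C suc (suc k)
  lemma : ∀ k x y → suc k * (x + y) ≡ x + (k * x + suc k * y)
  lemma = solve-∀
  lemma′ : ∀ x n a b → x + (n * a + n * b) ≡ x + n * (a + b)
  lemma′ = solve-∀

-- The two products in the Lagrange inversion formula; V is 0 when p or q is.
U V : ℕ → ℕ → ℕ → ℕ → ℕ
U s t p q = ((s + 2 * q) C p) * ((t + 2 * p) C q)
V s t (suc p) (suc q) = ((s + suc (2 * q)) C p) * ((t + suc (2 * p)) C q)
V s t _       _       = 0

V-zeroʳ : ∀ s t p → V s t p 0 ≡ 0
V-zeroʳ s t zero    = refl
V-zeroʳ s t (suc p) = refl

U-swap : ∀ s t p q → U s t p q ≡ U t s q p
U-swap s t p q = *-comm ((s + 2 * q) C p) _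

V-swap : ∀ s t p q → V s t p q ≡ V t s q p
V-swap s t zero    zero    = refl
V-swap s t zero    (suc q) = refl
V-swap s t (suc p) zero    = refl
V-swap s t (suc p) (suc q) = *-comm ((s + suc (2 * q)) C p) _

shift-even : ∀ t p → t + 2 * suc p ≡ 2 + t + 2 * p
shift-even = solve-∀

shift-odd : ∀ t p → t + suc (2 * suc p) ≡ 2 + t + suc (2 * p)
shift-odd = solve-∀

pascal-* : ∀ n k x → (suc n C suc k) * x ≡ (n C suc k) * x + (n C k) * x
pascal-* n k x = begin
  (suc n C suc k) * x            ≡⟨ cong (_* x) (pascal n k) ⟩
  (n C k + n C suc k) * x        ≡⟨ cong (_* x) (+-comm (n C k) _) ⟩
  (n C suc k + n C k) * x        ≡⟨ *-distribʳ-+ x (n C suc k) _ ⟩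
  (n C suc k) * x + (n C k) * x  ∎
  where open ≡-Reasoning

-- Pascal's rule splits the first factor. In the second, t + 2(p+1) = (t+2) + 2p, so lowering `p` by
-- one is compensated by raising `t` by two; this produces the term x F^s G^(t+2).
U-sucˡ : ∀ s t p q → U (suc s) t (suc p) q ≡ U s t (suc p) q + U s (2 + t) p q
U-sucˡ s t p q = trans (pascal-* (s + 2 * q) p _)
  (cong (λ x → U s t (suc p) q + ((s + 2 * q) C p) * (x C q)) (shift-even t p))

V-sucˡ : ∀ s t p q → V (suc s) t (suc p) q ≡ V s t (suc p) q + V s (2 + t) p q
V-sucˡ s t p       zero    = sym (V-zeroʳ s (2 + t) p)
-- Here the last summand is 0, and the first factors on both sides are binomials C(_, 0) = 1.
V-sucˡ s t zero    (suc q) = trans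
  (cong (_* ((t + 1) C q)) (sym (nC0≡1 (s + suc (2 * q)))))
  (sym (+-identityʳ _))
V-sucˡ s t (suc p) (suc q) = trans (pascal-* (s + suc (2 * q)) p _)
  (cong (λ x → V s t (2 + p) (suc q) + ((s + suc (2 * q)) C p) * (x C q)) (shift-odd t p))

-- The mirror image of `U-sucˡ` under exchanging (s, p) with (t, q).
U-sucʳ : ∀ s t p q → U s (suc t) p (suc q) ≡ U s t p (suc q) + U (2 + s) t p q
U-sucʳ s t p q = begin
  U s (suc t) p (suc q)                  ≡⟨ U-swap s (suc t) p (suc q) ⟩
  U (suc t) s (suc q) p                  ≡⟨ U-sucˡ t s q p ⟩
  U t s (suc q) p + U t (2 + s) q p      ≡⟨ cong₂ _+_ (U-swap t s (suc q) p) (U-swap t (2 + s) q p) ⟩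
  U s t p (suc q) + U (2 + s) t p q      ∎
  where open ≡-Reasoning

V-sucʳ : ∀ s t p q → V s (suc t) p (suc q) ≡ V s t p (suc q) + V (2 + s) t p q
V-sucʳ s t p q = begin
  V s (suc t) p (suc q)                  ≡⟨ V-swap s (suc t) p (suc q) ⟩
  V (suc t) s (suc q) p                  ≡⟨ V-sucˡ t s q p ⟩
  V t s (suc q) p + V t (2 + s) q p      ≡⟨ cong₂ _+_ (V-swap t s (suc q) p) (V-swap t (2 + s) q p) ⟩
  V s t p (suc q) + V (2 + s) t p q      ∎
  where open ≡-Reasoning

-- With no trees at all, the coefficient of x^(p+1) y^(q+1) must vanish. Absorption in both factors
-- turns `V` into `U` at the cost of (2q+2)(2p+2) / ((p+1)(q+1)), which is where the 4 comes from.
4V≡U : ∀ p q → 4 * V 0 0 (suc p) (suc q) ≡ U 0 0 (suc p) (suc q)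
4V≡U p q = *-cancelˡ-≡ _ _ (suc p * suc q) (begin
  suc p * suc q * (4 * (A * B))                   ≡⟨ lemma₁ p q A B ⟩
  (2 + 2 * q) * A * ((2 + 2 * p) * B)             ≡⟨ cong₂ _*_ (absorption (suc (2 * q)) p) (absorption (suc (2 * p)) q) ⟨
  suc p * ((2 + 2 * q) C suc p) * (suc q * ((2 + 2 * p) C suc q))
                                                  ≡⟨ cong₂ (λ x y → suc p * (x C suc p) * (suc q * (y C suc q))) (shift-even 0 q) (shift-even 0 p) ⟨
  suc p * A′ * (suc q * B′)                       ≡⟨ lemma₂ (suc p) (suc q) A′ B′ ⟩
  suc p * suc q * (A′ * B′)                       ∎)
  where
  open ≡-Reasoning
  A  = suc (2 * q) C p
  B  = suc (2 * p) C q
  A′ = (2 * suc q) C suc p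
  B′ = (2 * suc p) C suc q
  lemma₁ : ∀ p q a b → suc p * suc q * (4 * (a * b)) ≡ (2 + 2 * q) * a * ((2 + 2 * p) * b)
  lemma₁ = solve-∀
  lemma₂ : ∀ p q a b → p * a * (q * b) ≡ p * q * (a * b)
  lemma₂ = solve-∀

-- Closed form for the number of forests

length-map-++ : ∀ {A B C : Set} (f : A → C) (g : B → C) xs ys →
  length (map f xs ++ map g ys) ≡ length xs + length ys
length-map-++ f g xs ys =
  trans (length-++ (map f xs)) (cong₂ _+_ (length-map f xs) (length-map g ys))

+-4*-distrib : ∀ a b v w → a + b + 4 * (v + w) ≡ (a + 4 * v) + (b + 4 * w)
+-4*-distrib = solve-∀

-- Induction along the recursion of `forests`: the count, `U` and `V` obey the same recurrences, and
-- `4V≡U` settles the case of no trees and positive counts. The subtracted product stands on the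
-- left to avoid truncated subtraction.
length-forests : ∀ s t p q → length (forests s t p q) + 4 * V s t p q ≡ U s t p q
length-forests zero zero zero zero = refl
length-forests zero zero zero (suc q) = sym (*-zeroʳ ((2 * suc q) C 0))
length-forests zero zero (suc p) zero = refl
length-forests zero zero (suc p) (suc q) = 4V≡U p q
length-forests zero (suc t) p zero = begin
  length (map leafʳ (forests zero t p zero)) + 4 * V 0 (suc t) p 0
    ≡⟨ cong₂ (λ x y → x + 4 * y) (length-map leafʳ (forests zero t p zero))
         (trans (V-zeroʳ 0 (suc t) p) (sym (V-zeroʳ 0 t p))) ⟩
  length (forests zero t p zero) + 4 * V 0 t p 0
    ≡⟨ length-forests zero t p zero ⟩
  U 0 t p 0
    ≡⟨ cong ((0 C p) *_) (trans (nC0≡1 (t + 2 * p)) (sym (nC0≡1 (suc t + 2 * p)))) ⟩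
  U 0 (suc t) p 0 ∎
  where open ≡-Reasoning
length-forests zero (suc t) p (suc q) = begin
  length (map leafʳ fs ++ map nodeʳ gs) + 4 * V 0 (suc t) p (suc q)
    ≡⟨ cong₂ (λ x y → x + 4 * y) (length-map-++ leafʳ nodeʳ fs gs) (V-sucʳ 0 t p q) ⟩
  length fs + length gs + 4 * (V 0 t p (suc q) + V 2 t p q)
    ≡⟨ +-4*-distrib (length fs) (length gs) (V 0 t p (suc q)) (V 2 t p q) ⟩
  (length fs + 4 * V 0 t p (suc q)) + (length gs + 4 * V 2 t p q)
    ≡⟨ cong₂ _+_ (length-forests zero t p (suc q)) (length-forests 2 t p q) ⟩
  U 0 t p (suc q) + U 2 t p q
    ≡⟨ U-sucʳ 0 t p q ⟨
  U 0 (suc t) p (suc q) ∎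
  where
  open ≡-Reasoning
  fs = forests zero t p (suc q)
  gs = forests 2 t p q
length-forests (suc s) t zero q = begin
  length (map leafˡ (forests s t zero q)) + 0
    ≡⟨ cong (_+ 0) (length-map leafˡ (forests s t zero q)) ⟩
  length (forests s t zero q) + 0
    ≡⟨ length-forests s t zero q ⟩
  U s t 0 q
    ≡⟨ cong (_* ((t + 0) C q)) (trans (nC0≡1 (s + 2 * q)) (sym (nC0≡1 (suc s + 2 * q)))) ⟩
  U (suc s) t 0 q ∎
  where open ≡-Reasoning
length-forests (suc s) t (suc p) q = begin
  length (map leafˡ fs ++ map nodeˡ gs) + 4 * V (suc s) t (suc p) q
    ≡⟨ cong₂ (λ x y → x + 4 * y) (length-map-++ leafˡ nodeˡ fs gs) (V-sucˡ s t p q) ⟩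
  length fs + length gs + 4 * (V s t (suc p) q + V s (2 + t) p q)
    ≡⟨ +-4*-distrib (length fs) (length gs) (V s t (suc p) q) (V s (2 + t) p q) ⟩
  (length fs + 4 * V s t (suc p) q) + (length gs + 4 * V s (2 + t) p q)
    ≡⟨ cong₂ _+_ (length-forests s t (suc p) q) (length-forests s (2 + t) p q) ⟩
  U s t (suc p) q + U s (2 + t) p q
    ≡⟨ U-sucˡ s t p q ⟨
  U (suc s) t (suc p) q ∎
  where
  open ≡-Reasoning
  fs = forests s t (suc p) q
  gs = forests s (2 + t) p q

-- The diagonal coefficients of F

central-binomial : ∀ m → (2 * suc m) C suc m ≡ 2 * (suc (2 * m) C m)
central-binomial m = *-cancelˡ-≡ _ _ (suc m) (begin
  suc m * ((2 * suc m) C suc m)     ≡⟨ cong (λ x → suc m * (x C suc m)) (shift-even 0 m) ⟩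
  suc m * ((2 + 2 * m) C suc m)     ≡⟨ absorption (suc (2 * m)) m ⟩
  (2 + 2 * m) * (suc (2 * m) C m)   ≡⟨ lemma m (suc (2 * m) C m) ⟩
  suc m * (2 * (suc (2 * m) C m))   ∎)
  where
  open ≡-Reasoning
  lemma : ∀ m d → (2 + 2 * m) * d ≡ suc m * (2 * d)
  lemma = solve-∀

-- After (m+1) C(2m+2, m) is added, both sides equal (m+1) C(2m+3, m+1): the left by absorption, the
-- right by Pascal's rule.
central-ratio : ∀ m → (2 + m) * ((2 + 2 * m) C m) ≡ suc m * ((2 + 2 * m) C suc m)
central-ratio m = +-cancelˡ-≡ (suc m * E) _ _ (begin
  suc m * E + (2 + m) * E          ≡⟨ lemma m E ⟩
  (3 + 2 * m) * E                  ≡⟨ absorption (2 + 2 * m) m ⟨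
  suc m * ((3 + 2 * m) C suc m)    ≡⟨ cong (suc m *_) (pascal (2 + 2 * m) m) ⟩
  suc m * (E + B)                  ≡⟨ *-distribˡ-+ (suc m) E B ⟩
  suc m * E + suc m * B            ∎)
  where
  open ≡-Reasoning
  E = (2 + 2 * m) C m
  B = (2 + 2 * m) C suc m
  lemma : ∀ m e → suc m * e + (2 + m) * e ≡ (3 + 2 * m) * e
  lemma = solve-∀

-- For n = m + 1 the closed form reads W + 4ED = (E + B)B. Since B = 2D, this is W + EB = B², and
-- (m+2)E = (m+1)B then leaves (m+2)W = B².
length-fairForests-* : ∀ n → length (forests 1 0 n n) * suc n ≡ ((2 * n) C n) * ((2 * n) C n)
length-fairForests-* zero    = refl
length-fairForests-* (suc m) = +-cancelʳ-≡ (suc m * B * B) _ _ (begin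
  W * (2 + m) + suc m * B * B        ≡⟨ cong (λ x → W * (2 + m) + x * B) suc-m*B ⟨
  W * (2 + m) + (2 + m) * E * B      ≡⟨ lemma₁ W m E B ⟩
  (2 + m) * (W + E * B)              ≡⟨ cong ((2 + m) *_) W+EB ⟩
  (2 + m) * (B * B)                  ≡⟨ lemma₂ m B ⟩
  B * B + suc m * B * B              ∎)
  where
  open ≡-Reasoning
  W = length (forests 1 0 (suc m) (suc m))
  B = (2 * suc m) C suc m
  D = suc (2 * m) C m
  E = (2 + 2 * m) C m
  suc-m*B : (2 + m) * E ≡ suc m * B
  suc-m*B = trans (central-ratio m) (cong (λ x → suc m * (x C suc m)) (sym (shift-even 0 m)))
  lemma₁ : ∀ w m e b → w * (2 + m) + (2 + m) * e * b ≡ (2 + m) * (w + e * b)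
  lemma₁ = solve-∀
  lemma₂ : ∀ m b → (2 + m) * (b * b) ≡ b * b + suc m * b * b
  lemma₂ = solve-∀
  lemma₃ : ∀ w e d → w + e * (2 * d) + e * (2 * d) ≡ w + 4 * (e * d)
  lemma₃ = solve-∀
  lemma₄ : ∀ e b → (e + b) * b ≡ b * b + e * b
  lemma₄ = solve-∀
  W+EB : W + E * B ≡ B * B
  W+EB = +-cancelʳ-≡ (E * B) _ _ (begin
    W + E * B + E * B                  ≡⟨ cong (λ x → W + E * x + E * x) (central-binomial m) ⟩
    W + E * (2 * D) + E * (2 * D)      ≡⟨ lemma₃ W E D ⟩
    W + 4 * V 1 0 (suc m) (suc m)      ≡⟨ length-forests 1 0 (suc m) (suc m) ⟩
    (suc (2 * suc m) C suc m) * B      ≡⟨ cong (_* B) (pascal (2 * suc m) m) ⟩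
    ((2 * suc m) C m + B) * B          ≡⟨ cong (λ x → (x C m + B) * B) (shift-even 0 m) ⟩
    (E + B) * B                        ≡⟨ lemma₄ E B ⟩
    B * B + E * B                      ∎)

length-fairForests : ∀ n → length (forests 1 0 n n) ≡ (((2 * n) C n) * ((2 * n) C n)) / suc n
length-fairForests n = begin
  W                                          ≡⟨ m*n/n≡m W (suc n) ⟨
  W * suc n / suc n                          ≡⟨ cong (_/ suc n) (length-fairForests-* n) ⟩
  (((2 * n) C n) * ((2 * n) C n)) / suc n    ∎
  where
  open ≡-Reasoning
  W = length (forests 1 0 n n)

-- Trees with n nodes at even and n nodes at odd depth

tree : Forest 1 0 → Tree
tree (t ∷ [] , []) = t

tree-injective : ∀ {f g} → tree f ≡ tree g → f ≡ g
tree-injective {_ ∷ [] , []} {_ ∷ [] , []} refl = refl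

fairTrees : ℕ → List Tree
fairTrees n = map tree (forests 1 0 n n)

fairTrees-unique : ∀ n → Unique (fairTrees n)
fairTrees-unique n = Unique.map⁺ tree-injective (forests-unique 1 0 n n)

x+0+0≡x : ∀ x → x + 0 + 0 ≡ x
x+0+0≡x = solve-∀

fairTrees-sound : ∀ n {t} → t ∈ fairTrees n → evens t ≡ n × odds t ≡ n
fairTrees-sound n t∈ with (t ∷ [] , []) , f∈ , refl ← ∈-map⁻ tree t∈ =
  let eq , eq′ = All.lookup (forests-sound 1 0 n n) f∈
  in trans (sym (x+0+0≡x (evens t))) eq , trans (sym (x+0+0≡x (odds t))) eq′

fairTrees-complete : ∀ n {t} → evens t ≡ n → odds t ≡ n → t ∈ fairTrees n
fairTrees-complete n {t} eq eq′ = ∈-map⁺ tree (forests-complete 1 0 n n (t ∷ [] , [])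
  (trans (x+0+0≡x (evens t)) eq , trans (x+0+0≡x (odds t)) eq′))

length-fairTrees : ∀ n → length (fairTrees n) ≡ (((2 * n) C n) * ((2 * n) C n)) / suc n
length-fairTrees n = trans (length-map tree (forests 1 0 n n)) (length-fairForests n)

-- From trees to triangulations

Triple : Set
Triple = ℕ × ℕ × ℕ

_≟³_ : DecidableEquality Triple
_≟³_ = ≡-dec _≟_ (≡-dec _≟_ _≟_)

-- A leaf stands for the segment from `i` to `suc i`. A node joins the ranges of its two subtrees,
-- which meet at the apex `end l i` of its triangle.
end : Tree → ℕ → ℕ
end leaf       i = suc i
end (node l r) i = end r (end l i)

-- The tree t triangulates the polygon with vertices i , … , end t i.
triangles : Tree → ℕ → List Triple
triangles leaf       i = []
triangles (node l r) i = (i , end l i , end r (end l i)) ∷ triangles l i ++ triangles r (end l i)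

i<end : ∀ t i → i < end t i
i<end leaf       i = ≤-refl
i<end (node l r) i = <-trans (i<end l i) (i<end r (end l i))

-- A tree with k nodes has k + 1 leaves, and each leaf advances the endpoint by one.
end-size : ∀ t i → end t i ≡ suc (i + (evens t + odds t))
end-size leaf       i = cong suc (sym (+-identityʳ i))
end-size (node l r) i = begin
  end r (end l i)                                             ≡⟨ end-size r (end l i) ⟩
  suc (end l i + (evens r + odds r))                          ≡⟨ cong (λ x → suc (x + (evens r + odds r))) (end-size l i) ⟩
  suc (suc (i + (evens l + odds l)) + (evens r + odds r))     ≡⟨ lemma i (evens l) (odds l) (evens r) (odds r) ⟩
  suc (i + (suc (odds l + odds r) + (evens l + evens r)))     ∎
  where
  open ≡-Reasoning
  lemma : ∀ i a b c d → suc (suc (i + (a + b)) + (c + d)) ≡ suc (i + (suc (b + d) + (a + c)))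
  lemma = solve-∀

length-triangles : ∀ t i → length (triangles t i) ≡ evens t + odds t
length-triangles leaf       i = refl
length-triangles (node l r) i = begin
  suc (length (triangles l i ++ triangles r (end l i)))            ≡⟨ cong suc (length-++ (triangles l i)) ⟩
  suc (length (triangles l i) + length (triangles r (end l i)))    ≡⟨ cong suc (cong₂ _+_ (length-triangles l i) (length-triangles r (end l i))) ⟩
  suc (evens l + odds l + (evens r + odds r))                      ≡⟨ lemma (evens l) (odds l) (evens r) (odds r) ⟩
  suc (odds l + odds r) + (evens l + evens r)                      ∎
  where
  open ≡-Reasoning
  lemma : ∀ a b c d → suc (a + b + (c + d)) ≡ suc (b + d) + (a + c)
  lemma = solve-∀

data Position (l r : Tree) (i : ℕ) (x : Triple) : Set where
  root  : x ≡ (i , end l i , end r (end l i)) → Position l r i x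
  left  : x ∈ triangles l i → Position l r i x
  right : x ∈ triangles r (end l i) → Position l r i x

position : ∀ l r i {x} → x ∈ triangles (node l r) i → Position l r i x
position l r i (here eq) = root eq
position l r i (there x∈) with ∈-++⁻ (triangles l i) x∈
... | inj₁ x∈l = left x∈l
... | inj₂ x∈r = right x∈r

∈-left : ∀ l r i {x} → x ∈ triangles l i → x ∈ triangles (node l r) i
∈-left l r i x∈ = there (∈-++⁺ˡ x∈)

∈-right : ∀ l r i {x} → x ∈ triangles r (end l i) → x ∈ triangles (node l r) i
∈-right l r i x∈ = there (∈-++⁺ʳ (triangles l i) x∈)

Inside : ℕ → ℕ → Triple → Set
Inside i j (a , b , c) = i ≤ a × a < b × b < c × c ≤ j

Inside-mono : ∀ {i i′ j j′ x} → i′ ≤ i → j ≤ j′ → Inside i j x → Inside i′ j′ x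
Inside-mono i′≤i j≤j′ (i≤a , a<b , b<c , c≤j) = ≤-trans i′≤i i≤a , a<b , b<c , ≤-trans c≤j j≤j′

inside : ∀ t i {x} → x ∈ triangles t i → Inside i (end t i) x
inside (node l r) i x∈ with position l r i x∈
... | root refl = ≤-refl , i<end l i , i<end r (end l i) , ≤-refl
... | left x∈l  = Inside-mono ≤-refl (<⇒≤ (i<end r (end l i))) (inside l i x∈l)
... | right x∈r = Inside-mono (<⇒≤ (i<end l i)) ≤-refl (inside r (end l i) x∈r)

On : ℕ → Triple → Set
On u (a , b , c) = u ≡ a ⊎ u ≡ b ⊎ u ≡ c

On⇒bounds : ∀ {i j u} x → Inside i j x → On u x → i ≤ u × u ≤ j
On⇒bounds _ (i≤a , a<b , b<c , c≤j) (inj₁ refl) = i≤a , <⇒≤ (<-trans a<b (<-≤-trans b<c c≤j))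
On⇒bounds _ (i≤a , a<b , b<c , c≤j) (inj₂ (inj₁ refl)) = ≤-trans i≤a (<⇒≤ a<b) , ≤-trans (<⇒≤ b<c) c≤j
On⇒bounds _ (i≤a , a<b , b<c , c≤j) (inj₂ (inj₂ refl)) = <⇒≤ (≤-<-trans i≤a (<-trans a<b b<c)) , c≤j

-- Binary search: `b` is compared with the apex of the root. The result supplies the triangle with
-- which a member of a triangulation is later identified.
triangles-middle : ∀ t i b → i < b → b < end t i → ∃₂ λ a c → (a , b , c) ∈ triangles t i
triangles-middle leaf i b i<b b<1+i = contradiction b<1+i (≤⇒≯ i<b)
triangles-middle (node l r) i b i<b b<j with <-cmp b (end l i)
... | tri< b<k _ _ = let a , c , x∈ = triangles-middle l i b i<b b<k in a , c , ∈-left l r i x∈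
... | tri≈ _ refl _ = i , end r b , here refl
... | tri> _ _ b>k = let a , c , x∈ = triangles-middle r (end l i) b b>k b<j in a , c , ∈-right l r i x∈

triangles-unique : ∀ t i → Unique (triangles t i)
triangles-unique leaf i = []
triangles-unique (node l r) i =
  All.tabulate root∉ ∷ Unique.++⁺ (triangles-unique l i) (triangles-unique r k) λ (x∈l , x∈r) →
    let _ , a<b , b<c , c≤k = inside l i x∈l
        k≤a , _ = inside r k x∈r
    in <-irrefl refl (<-≤-trans (<-trans a<b b<c) (≤-trans c≤k k≤a))
  where
  k = end l i
  root∉ : ∀ {x} → x ∈ triangles l i ++ triangles r k → (i , k , end r k) ≢ x
  root∉ x∈ refl with ∈-++⁻ (triangles l i) x∈
  ... | inj₁ x∈l = let _ , _ , k<j , j≤k = inside l i x∈l in <-irrefl refl (<-≤-trans k<j j≤k)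
  ... | inj₂ x∈r = let k≤i , i<k , _ = inside r k x∈r in <-irrefl refl (<-≤-trans i<k k≤i)

-- Triangles of the subtrees stay within [i, k] or [k, j], where i < k < j, so only the root has
-- both extreme vertices.
root-middle : ∀ l r i {b} → (i , b , end (node l r) i) ∈ triangles (node l r) i → b ≡ end l i
root-middle l r i x∈ with position l r i x∈
... | root refl = refl
... | left x∈l  = let _ , _ , _ , j≤k = inside l i x∈l in contradiction j≤k (<⇒≱ (i<end r (end l i)))
... | right x∈r = let k≤i , _ = inside r (end l i) x∈r in contradiction k≤i (<⇒≱ (i<end l i))

-- By `root-middle`, the root triangle of the first tree is also the root of the second, so the
-- apexes agree. The range of any other triangle then decides which subtree of the second tree
-- contains it.
triangles-injective : ∀ t t′ i → end t i ≡ end t′ i →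
  (∀ {x} → x ∈ triangles t i → x ∈ triangles t′ i) → t ≡ t′
triangles-injective leaf leaf i _ _ = refl
triangles-injective leaf (node l r) i eq _ =
  contradiction (subst (_≤ end l i) eq (i<end l i)) (<⇒≱ (i<end r (end l i)))
triangles-injective (node l r) leaf i _ sub with () ← sub (here refl)
triangles-injective (node l r) (node l′ r′) i eq sub =
  cong₂ node (triangles-injective l l′ i k≡k′ sub-left)
    (triangles-injective r r′ (end l i) (trans eq (cong (end r′) (sym k≡k′))) sub-right)
  where
  k≡k′ : end l i ≡ end l′ i
  k≡k′ = root-middle l′ r′ i (subst (λ j → (i , end l i , j) ∈ triangles (node l′ r′) i) eq (sub (here refl)))
  sub-left : ∀ {x} → x ∈ triangles l i → x ∈ triangles l′ i
  sub-left x∈ with position l′ r′ i (sub (∈-left l r i x∈)) | inside l i x∈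
  ... | root refl | _ , _ , b<c , c≤k = contradiction (sym k≡k′) (<⇒≢ (<-≤-trans b<c c≤k))
  ... | left x∈l′ | _ = x∈l′
  ... | right x∈r′ | _ , a<b , b<c , c≤k =
    contradiction (≤-trans (≤-reflexive k≡k′) (proj₁ (inside r′ _ x∈r′))) (<⇒≱ (<-≤-trans (<-trans a<b b<c) c≤k))
  sub-right : ∀ {x} → x ∈ triangles r (end l i) → x ∈ triangles r′ (end l i)
  sub-right {x} x∈ with position l′ r′ i (sub (∈-right l r i x∈)) | inside r (end l i) x∈
  ... | root refl | k≤a , a<b , _ = contradiction k≡k′ (<⇒≢ (≤-<-trans k≤a a<b))
  ... | left x∈l′ | k≤a , a<b , b<c , _ =
    let _ , _ , _ , c≤k′ = inside l′ i x∈l′ in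
    contradiction (≤-trans (≤-trans c≤k′ (≤-reflexive (sym k≡k′))) k≤a) (<⇒≱ (<-trans a<b b<c))
  ... | right x∈r′ | _ = subst (λ k → x ∈ triangles r′ k) (sym k≡k′) x∈r′

-- `InteriorDisjoint` written on natural-number labels, so that on images under `toNats` the two
-- agree by computation.
NonOverlapping : Triple → Triple → Set
NonOverlapping (a , b , c) (d , e , f) =
  ((a ≤ d × d ≤ b) × (a ≤ e × e ≤ b) × (a ≤ f × f ≤ b)) ⊎
  ((b ≤ d × d ≤ c) × (b ≤ e × e ≤ c) × (b ≤ f × f ≤ c)) ⊎
  ((c ≤ d ⊎ d ≤ a) × (c ≤ e ⊎ e ≤ a) × (c ≤ f ⊎ f ≤ a))

Inside⇒bounds : ∀ {i j d e f} → Inside i j (d , e , f) →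
  (i ≤ d × d ≤ j) × (i ≤ e × e ≤ j) × (i ≤ f × f ≤ j)
Inside⇒bounds ins =
  On⇒bounds _ ins (inj₁ refl) , On⇒bounds _ ins (inj₂ (inj₁ refl)) , On⇒bounds _ ins (inj₂ (inj₂ refl))

triangles-nonOverlapping : ∀ t i {x y} → x ∈ triangles t i → y ∈ triangles t i → x ≢ y → NonOverlapping x y
triangles-nonOverlapping (node l r) i x∈ y∈ x≢y with position l r i x∈ | position l r i y∈
... | root refl | root refl = contradiction refl x≢y
... | root refl | left y∈l  = inj₁ (Inside⇒bounds (inside l i y∈l))
... | root refl | right y∈r = inj₂ (inj₁ (Inside⇒bounds (inside r (end l i) y∈r)))
-- Seen from a triangle of a subtree, the root and the other subtree lie on the outer arc, from `c`
-- around to `a`.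
... | left x∈l  | root refl =
  let i≤a , _ , _ , c≤k = inside l i x∈l
  in inj₂ (inj₂ (inj₂ i≤a , inj₁ c≤k , inj₁ (≤-trans c≤k (<⇒≤ (i<end r (end l i))))))
... | left x∈l  | left y∈l  = triangles-nonOverlapping l i x∈l y∈l x≢y
... | left x∈l  | right y∈r =
  let _ , _ , _ , c≤k = inside l i x∈l
      (k≤d , _) , (k≤e , _) , (k≤f , _) = Inside⇒bounds (inside r (end l i) y∈r)
  in inj₂ (inj₂ (inj₁ (≤-trans c≤k k≤d) , inj₁ (≤-trans c≤k k≤e) , inj₁ (≤-trans c≤k k≤f)))
... | right x∈r | root refl =
  let k≤a , _ , _ , c≤j = inside r (end l i) x∈r
  in inj₂ (inj₂ (inj₂ (≤-trans (<⇒≤ (i<end l i)) k≤a) , inj₂ k≤a , inj₁ c≤j))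
... | right x∈r | left y∈l  =
  let k≤a , _ = inside r (end l i) x∈r
      (_ , d≤k) , (_ , e≤k) , (_ , f≤k) = Inside⇒bounds (inside l i y∈l)
  in inj₂ (inj₂ (inj₂ (≤-trans d≤k k≤a) , inj₂ (≤-trans e≤k k≤a) , inj₂ (≤-trans f≤k k≤a)))
... | right x∈r | right y∈r = triangles-nonOverlapping r (end l i) x∈r y∈r x≢y

-- Shared sides and the alternating colouring

Adjacent : Triple → Triple → Set
Adjacent x y = ∃₂ λ u v → u ≢ v × On u x × On v x × On u y × On v y

Adjacent-sym : ∀ {x y} → Adjacent x y → Adjacent y x
Adjacent-sym (u , v , u≢v , ux , vx , uy , vy) = u , v , u≢v , uy , vy , ux , vx

On-lower : ∀ {i j a b c} → Inside i j (a , b , c) → On i (a , b , c) → a ≡ i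
On-lower _ (inj₁ i≡a) = sym i≡a
On-lower (i≤a , a<b , _) (inj₂ (inj₁ refl)) = contradiction a<b (≤⇒≯ i≤a)
On-lower (i≤a , a<b , b<c , _) (inj₂ (inj₂ refl)) = contradiction (<-trans a<b b<c) (≤⇒≯ i≤a)

On-upper : ∀ {i j a b c} → Inside i j (a , b , c) → On j (a , b , c) → c ≡ j
On-upper (_ , a<b , b<c , c≤j) (inj₁ refl) = contradiction (<-trans a<b b<c) (≤⇒≯ c≤j)
On-upper (_ , _ , b<c , c≤j) (inj₂ (inj₁ refl)) = contradiction b<c (≤⇒≯ c≤j)
On-upper _ (inj₂ (inj₂ j≡c)) = sym j≡c

ends : ∀ {i j a b c} → Inside i j (a , b , c) → On i (a , b , c) → On j (a , b , c) →
  (a , b , c) ≡ (i , b , j)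
ends {b = b} ins oni onj = cong₂ (λ x y → x , b , y) (On-lower ins oni) (On-upper ins onj)

-- The vertex `j` lies outside [i, k], so the two common vertices are `i` and `k`, and these must be
-- the extreme vertices of the second triangle. Hence the root borders only the top triangle of its
-- left subtree.
adjacent-left : ∀ {i k j a b c} → k < j → Inside i k (a , b , c) →
  Adjacent (i , k , j) (a , b , c) → (a , b , c) ≡ (i , b , k)
adjacent-left k<j ins (u , v , u≢v , inj₂ (inj₂ refl) , vx , uy , vy) =
  contradiction (proj₂ (On⇒bounds _ ins uy)) (<⇒≱ k<j)
adjacent-left k<j ins (u , v , u≢v , ux , inj₂ (inj₂ refl) , uy , vy) =
  contradiction (proj₂ (On⇒bounds _ ins vy)) (<⇒≱ k<j)
adjacent-left k<j ins (u , v , u≢v , inj₁ refl , inj₁ refl , uy , vy) = contradiction refl u≢v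
adjacent-left k<j ins (u , v , u≢v , inj₁ refl , inj₂ (inj₁ refl) , uy , vy) = ends ins uy vy
adjacent-left k<j ins (u , v , u≢v , inj₂ (inj₁ refl) , inj₁ refl , uy , vy) = ends ins vy uy
adjacent-left k<j ins (u , v , u≢v , inj₂ (inj₁ refl) , inj₂ (inj₁ refl) , uy , vy) = contradiction refl u≢v

adjacent-right : ∀ {i k j a b c} → i < k → Inside k j (a , b , c) →
  Adjacent (i , k , j) (a , b , c) → (a , b , c) ≡ (k , b , j)
adjacent-right i<k ins (u , v , u≢v , inj₁ refl , vx , uy , vy) =
  contradiction (proj₁ (On⇒bounds _ ins uy)) (<⇒≱ i<k)
adjacent-right i<k ins (u , v , u≢v , ux , inj₁ refl , uy , vy) =
  contradiction (proj₁ (On⇒bounds _ ins vy)) (<⇒≱ i<k)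
adjacent-right i<k ins (u , v , u≢v , inj₂ (inj₁ refl) , inj₂ (inj₁ refl) , uy , vy) = contradiction refl u≢v
adjacent-right i<k ins (u , v , u≢v , inj₂ (inj₁ refl) , inj₂ (inj₂ refl) , uy , vy) = ends ins uy vy
adjacent-right i<k ins (u , v , u≢v , inj₂ (inj₂ refl) , inj₂ (inj₁ refl) , uy , vy) = ends ins vy uy
adjacent-right i<k ins (u , v , u≢v , inj₂ (inj₂ refl) , inj₂ (inj₂ refl) , uy , vy) = contradiction refl u≢v

-- The two ranges meet only in `k`, which leaves no second common vertex.
¬adjacent-apart : ∀ {i k j x y} → Inside i k x → Inside k j y → ¬ Adjacent x y
¬adjacent-apart {k = k} insx insy (u , v , u≢v , ux , vx , uy , vy) = u≢v (trans (≡k ux uy) (sym (≡k vx vy)))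
  where
  ≡k : ∀ {u} → On u _ → On u _ → u ≡ k
  ≡k ux uy = ≤-antisym (proj₂ (On⇒bounds _ insx ux)) (proj₁ (On⇒bounds _ insy uy))

Proper : List Triple → (Triple → Bool) → Set
Proper xs col = ∀ {x y} → x ∈ xs → y ∈ xs → x ≢ y → Adjacent x y → col x ≢ col y

-- Defined on all triples through the middle vertex; c is the colour of the root.
colour : Tree → ℕ → Bool → Triple → Bool
colour leaf       i c x = c
colour (node l r) i c x@(_ , b , _) with <-cmp b (end l i)
... | tri< _ _ _ = colour l i (not c) x
... | tri≈ _ _ _ = c
... | tri> _ _ _ = colour r (end l i) (not c) x

colour-root : ∀ l r i c {a d} → colour (node l r) i c (a , end l i , d) ≡ c
colour-root l r i c with <-cmp (end l i) (end l i)
... | tri< _ k≢k _ = contradiction refl k≢k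
... | tri≈ _ _ _   = refl
... | tri> _ k≢k _ = contradiction refl k≢k

colour-left : ∀ l r i c {x} → x ∈ triangles l i → colour (node l r) i c x ≡ colour l i (not c) x
colour-left l r i c {_ , b , _} x∈ with <-cmp b (end l i) | inside l i x∈
... | tri< _ _ _ | _ = refl
... | tri≈ b≮k _ _ | _ , _ , b<d , d≤k = contradiction (<-≤-trans b<d d≤k) b≮k
... | tri> b≮k _ _ | _ , _ , b<d , d≤k = contradiction (<-≤-trans b<d d≤k) b≮k

colour-right : ∀ l r i c {x} → x ∈ triangles r (end l i) →
  colour (node l r) i c x ≡ colour r (end l i) (not c) x
colour-right l r i c {_ , b , _} x∈ with <-cmp b (end l i) | inside r (end l i) x∈
... | tri< _ _ b≯k | k≤a , a<b , _ = contradiction (≤-<-trans k≤a a<b) b≯k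
... | tri≈ _ _ b≯k | k≤a , a<b , _ = contradiction (≤-<-trans k≤a a<b) b≯k
... | tri> _ _ _ | _ = refl

colour-top : ∀ t i c {b} → (i , b , end t i) ∈ triangles t i → colour t i c (i , b , end t i) ≡ c
colour-top (node l r) i c x∈ with refl ← root-middle l r i x∈ = colour-root l r i c

c≢not-c : ∀ c → c ≢ not c
c≢not-c true ()
c≢not-c false ()

-- An adjacent pair lies in one subtree, or consists of the root and the top triangle of a subtree,
-- whose colour is flipped by `not`. Triangles of different subtrees are never adjacent.
colour-proper : ∀ t i c → Proper (triangles t i) (colour t i c)
colour-proper (node l r) i c x∈ y∈ x≢y adj = go x∈ y∈ x≢y adj (position l r i x∈) (position l r i y∈)
  where
  k = end l i
  j = end r k
  root-left : ∀ {y} → y ∈ triangles l i → Adjacent (i , k , j) y →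
    colour (node l r) i c (i , k , j) ≢ colour (node l r) i c y
  root-left y∈ adj eq with refl ← adjacent-left (i<end r k) (inside l i y∈) adj =
    c≢not-c c (trans (sym (colour-root l r i c))
      (trans eq (trans (colour-left l r i c y∈) (colour-top l i (not c) y∈))))
  root-right : ∀ {y} → y ∈ triangles r k → Adjacent (i , k , j) y →
    colour (node l r) i c (i , k , j) ≢ colour (node l r) i c y
  root-right y∈ adj eq with refl ← adjacent-right (i<end l i) (inside r k y∈) adj =
    c≢not-c c (trans (sym (colour-root l r i c))
      (trans eq (trans (colour-right l r i c y∈) (colour-top r k (not c) y∈))))
  go : ∀ {x y} → x ∈ triangles (node l r) i → y ∈ triangles (node l r) i → x ≢ y → Adjacent x y →
    Position l r i x → Position l r i y → colour (node l r) i c x ≢ colour (node l r) i c y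
  go _ _ x≢y adj (root refl) (root refl) = contradiction refl x≢y
  go _ _ x≢y adj (root refl) (left y∈)   = root-left y∈ adj
  go _ _ x≢y adj (root refl) (right y∈)  = root-right y∈ adj
  go _ _ x≢y adj (left x∈)   (root refl) = ≢-sym (root-left x∈ (Adjacent-sym adj))
  go _ _ x≢y adj (right x∈)  (root refl) = ≢-sym (root-right x∈ (Adjacent-sym adj))
  go _ _ x≢y adj (left x∈)   (right y∈)  = contradiction adj (¬adjacent-apart (inside l i x∈) (inside r k y∈))
  go _ _ x≢y adj (right x∈)  (left y∈)   =
    contradiction (Adjacent-sym adj) (¬adjacent-apart (inside l i y∈) (inside r k x∈))
  go _ _ x≢y adj (left x∈)   (left y∈)   eq = colour-proper l i (not c) x∈ y∈ x≢y adj
    (trans (sym (colour-left l r i c x∈)) (trans eq (colour-left l r i c y∈)))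
  go _ _ x≢y adj (right x∈)  (right y∈)  eq = colour-proper r k (not c) x∈ y∈ x≢y adj
    (trans (sym (colour-right l r i c x∈)) (trans eq (colour-right l r i c y∈)))

-- Counting the colours of a proper colouring

blacks : Bool → Tree → ℕ
blacks true  = evens
blacks false = odds

countᵇ-++ : ∀ {A : Set} (p : A → Bool) xs ys → countᵇ p (xs ++ ys) ≡ countᵇ p xs + countᵇ p ys
countᵇ-++ p []       ys = refl
countᵇ-++ p (x ∷ xs) ys with p x
... | true  = cong suc (countᵇ-++ p xs ys)
... | false = countᵇ-++ p xs ys

≢⇒≡not : ∀ {a b} → a ≢ b → b ≡ not a
≢⇒≡not {true}  {true}  a≢b = contradiction refl a≢b
≢⇒≡not {true}  {false} a≢b = refl
≢⇒≡not {false} {true}  a≢b = refl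
≢⇒≡not {false} {false} a≢b = contradiction refl a≢b

not-injective : ∀ {a b} → not a ≡ not b → a ≡ b
not-injective {true}  {true}  _ = refl
not-injective {false} {false} _ = refl

-- Phrased as an implication so that it holds vacuously for a leaf, which has no triangle.
TopColour : Tree → ℕ → (Triple → Bool) → Bool → Set
TopColour t i col c = ∀ {b} → (i , b , end t i) ∈ triangles t i → col (i , b , end t i) ≡ c

topColour : ∀ t i col → ∃ (TopColour t i col)
-- The choice of `true` is arbitrary.
topColour leaf       i col = true , λ ()
topColour (node l r) i col =
  col (i , end l i , end (node l r) i) , λ x∈ → cong (λ b → col (i , b , _)) (root-middle l r i x∈)

-- The colour of the root forces the colours of its children, and so on downwards, so every proper
-- colouring is the parity of depth up to an exchange of the colours. This is the uniqueness of the
-- checkerboard colouring, in terms of counts.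
countᵇ-triangles : ∀ t i {col c} → Proper (triangles t i) col → TopColour t i col c →
  countᵇ col (triangles t i) ≡ blacks c t
countᵇ-triangles leaf i {c = true}  _ _ = refl
countᵇ-triangles leaf i {c = false} _ _ = refl
countᵇ-triangles (node l r) i {col} {c} proper top = add-root c (top (here refl)) (begin
  countᵇ col (triangles l i ++ triangles r k)                     ≡⟨ countᵇ-++ col (triangles l i) _ ⟩
  countᵇ col (triangles l i) + countᵇ col (triangles r k)         ≡⟨ cong₂ _+_ count-l count-r ⟩
  blacks (not c) l + blacks (not c) r                             ∎)
  where
  open ≡-Reasoning
  k = end l i
  j = end r k
  -- The root shares the side from `i` to `k` with the top triangle of `l`, and the side from `k` to
  -- `j` with that of `r`.
  child : ∀ {x} → x ∈ triangles (node l r) i → (i , k , j) ≢ x → Adjacent (i , k , j) x → col x ≡ not c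
  child x∈ x≢ adj = trans (≢⇒≡not (proper (here refl) x∈ x≢ adj)) (cong not (top (here refl)))
  count-l : countᵇ col (triangles l i) ≡ blacks (not c) l
  count-l = countᵇ-triangles l i (λ x∈ y∈ → proper (∈-left l r i x∈) (∈-left l r i y∈)) λ x∈ →
    let _ , _ , b<k , _ = inside l i x∈ in
    child (∈-left l r i x∈) (λ eq → <-irrefl (sym (cong (proj₁ ∘ proj₂) eq)) b<k)
      (i , k , <⇒≢ (i<end l i) , inj₁ refl , inj₂ (inj₁ refl) , inj₁ refl , inj₂ (inj₂ refl))
  count-r : countᵇ col (triangles r k) ≡ blacks (not c) r
  count-r = countᵇ-triangles r k (λ x∈ y∈ → proper (∈-right l r i x∈) (∈-right l r i y∈)) λ x∈ →
    let _ , k<b , _ = inside r k x∈ in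
    child (∈-right l r i x∈) (λ eq → <-irrefl (cong (proj₁ ∘ proj₂) eq) k<b)
      (k , j , <⇒≢ (i<end r k) , inj₂ (inj₁ refl) , inj₂ (inj₂ refl) , inj₁ refl , inj₂ (inj₂ refl))
  add-root : ∀ c → col (i , k , j) ≡ c →
    countᵇ col (triangles l i ++ triangles r k) ≡ blacks (not c) l + blacks (not c) r →
    countᵇ col (triangles (node l r) i) ≡ blacks c (node l r)
  add-root true  eq rest rewrite eq = cong suc rest
  add-root false eq rest rewrite eq = rest

-- `countᵇ-triangles` is applied twice: to `col` and to `not ∘ col`, which is also proper and has
-- the opposite colour at the root.
balanced⇒evens≡odds : ∀ t i {col} → Proper (triangles t i) col →
  countᵇ col (triangles t i) ≡ countᵇ (not ∘ col) (triangles t i) → evens t ≡ odds t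
balanced⇒evens≡odds t i {col} proper eq with topColour t i col
... | c , top = go c (trans (sym (countᵇ-triangles t i proper top)) (trans eq
    (countᵇ-triangles t i (λ x∈ y∈ x≢y adj eq → proper x∈ y∈ x≢y adj (not-injective eq)) (λ x∈ → cong not (top x∈)))))
  where
  go : ∀ c → blacks c t ≡ blacks (not c) t → evens t ≡ odds t
  go true  eq = eq
  go false eq = sym eq

evens≡odds⇒balanced : ∀ t i → evens t ≡ odds t →
  countᵇ (colour t i true) (triangles t i) ≡ countᵇ (not ∘ colour t i true) (triangles t i)
evens≡odds⇒balanced t i eq = begin
  countᵇ (colour t i true) (triangles t i)          ≡⟨ countᵇ-triangles t i (colour-proper t i true) (colour-top t i true) ⟩
  evens t                                           ≡⟨ eq ⟩
  odds t                                            ≡⟨ countᵇ-triangles t i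
                                                         (λ x∈ y∈ x≢y adj eq → colour-proper t i true x∈ y∈ x≢y adj (not-injective eq))
                                                         (λ x∈ → cong not (colour-top t i true x∈)) ⟨
  countᵇ (not ∘ colour t i true) (triangles t i)    ∎
  where open ≡-Reasoning

-- From triangulations to trees

-- A predicate on natural-number triples allows recursion on subranges without changing the vertex
-- type. The number of triangles enters only through `Covered`.
record NonCrossing (M : Triple → Set) : Set where
  field
    increasing     : ∀ {a b c} → M (a , b , c) → a < b × b < c
    nonOverlapping : ∀ {x y} → M x → M y → x ≢ y → NonOverlapping x y

  -- If the triangles differed, one arc of the first would contain the second. The arc [a, b] misses
  -- c′ > b, the arc [b, c] misses a′ < b, and the outer arc misses `b` itself.
  middle-unique : ∀ {a a′ b c c′} → M (a , b , c) → M (a′ , b , c′) → (a , b , c) ≡ (a′ , b , c′)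
  middle-unique {a} {a′} {b} {c} {c′} m m′ = decidable-stable ((a , b , c) ≟³ (a′ , b , c′)) λ x≢y →
    ¬overlap (nonOverlapping m m′ x≢y)
    where
    ¬overlap : ¬ NonOverlapping (a , b , c) (a′ , b , c′)
    ¬overlap (inj₁ (_ , _ , _ , c′≤b)) = contradiction c′≤b (<⇒≱ (proj₂ (increasing m′)))
    ¬overlap (inj₂ (inj₁ ((b≤a′ , _) , _))) = contradiction b≤a′ (<⇒≱ (proj₁ (increasing m′)))
    ¬overlap (inj₂ (inj₂ (_ , inj₁ c≤b , _))) = contradiction c≤b (<⇒≱ (proj₂ (increasing m)))
    ¬overlap (inj₂ (inj₂ (_ , inj₂ b≤a , _))) = contradiction b≤a (<⇒≱ (proj₁ (increasing m)))

  -- This expresses that `M` fills the polygon on `i`, ..., `j`, in a form that passes to both sides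
  -- of the root triangle.
  Covered : ℕ → ℕ → Set
  Covered i j = ∀ b → i < b → b < j → ∃₂ λ a c → M (a , b , c) × i ≤ a × c ≤ j

  -- The triangle with middle vertex c cannot overlap (i , k , c), which forces it to be
  -- (i , c , c′); the right end thus moves until it reaches j.
  rootFrom : ∀ {i j} → Covered i j → ∀ n {k c} → j ≤ c + n → c ≤ j → M (i , k , c) →
    ∃ λ k → M (i , k , j)
  rootFrom {i} {j} cov n {k} {c} j≤c+n c≤j m with m≤n⇒m<n∨m≡n c≤j
  ... | inj₂ refl = k , m
  rootFrom cov zero {c = c} j≤c+0 c≤j m | inj₁ c<j =
    contradiction (subst (_ ≤_) (+-identityʳ c) j≤c+0) (<⇒≱ c<j)
  rootFrom {i} {j} cov (suc n) {k} {c} j≤c+n c≤j m | inj₁ c<j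
    with a′ , c′ , m′ , i≤a′ , c′≤j ← cov c (<-trans (proj₁ (increasing m)) (proj₂ (increasing m))) c<j
    = rootFrom cov n
        (≤-trans j≤c+n (≤-trans (≤-reflexive (+-suc c n)) (+-monoˡ-≤ n c<c′))) c′≤j
        (subst (λ a → M (a , c , c′)) (≤-antisym a′≤i i≤a′) m′)
    where
    a′<c = proj₁ (increasing m′)
    c<c′ = proj₂ (increasing m′)
    a′≤i : a′ ≤ i
    a′≤i with nonOverlapping m m′ (λ eq → <⇒≢ c<c′ (cong (proj₂ ∘ proj₂) eq))
    ... | inj₁ (_ , (_ , c≤k) , _) = contradiction c≤k (<⇒≱ (proj₂ (increasing m)))
    ... | inj₂ (inj₁ (_ , _ , _ , c′≤c)) = contradiction c′≤c (<⇒≱ c<c′)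
    ... | inj₂ (inj₂ (inj₁ c≤a′ , _)) = contradiction c≤a′ (<⇒≱ a′<c)
    ... | inj₂ (inj₂ (inj₂ a′≤i , _)) = a′≤i

  -- The search starts at the triangle with middle vertex `suc i`: its least vertex is below `suc i`
  -- and at least `i`, hence equal to `i`.
  findRoot : ∀ {i j} → Covered i j → suc i < j → ∃ λ k → M (i , k , j)
  findRoot {i} {j} cov 1+i<j
    with a , c , m , i≤a , c≤j ← cov (suc i) ≤-refl 1+i<j
    = rootFrom cov j (m≤n+m j c) c≤j
        (subst (λ a → M (a , suc i , c)) (≤-antisym (s≤s⁻¹ (proj₁ (increasing m))) i≤a) m)

  -- Relative to the root (i , k , j), a triangle whose middle vertex lies strictly between `i` and
  -- `k` can only be on the arc [i, k], and likewise for [k, j].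
  split : ∀ {i k j} → M (i , k , j) → Covered i j → Covered i k × Covered k j
  split {i} {k} {j} m cov = below , above
    where
    i<k = proj₁ (increasing m)
    k<j = proj₂ (increasing m)
    below : Covered i k
    below b i<b b<k with a , c , m′ , i≤a , c≤j ← cov b i<b (<-trans b<k k<j)
      with nonOverlapping m m′ (λ eq → <⇒≢ b<k (sym (cong (proj₁ ∘ proj₂) eq)))
    ... | inj₁ (_ , _ , _ , c≤k) = a , c , m′ , i≤a , c≤k
    ... | inj₂ (inj₁ (_ , (k≤b , _) , _)) = contradiction k≤b (<⇒≱ b<k)
    ... | inj₂ (inj₂ (_ , inj₁ j≤b , _)) = contradiction j≤b (<⇒≱ (<-trans b<k k<j))
    ... | inj₂ (inj₂ (_ , inj₂ b≤i , _)) = contradiction b≤i (<⇒≱ i<b)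
    above : Covered k j
    above b k<b b<j with a , c , m′ , i≤a , c≤j ← cov b (<-trans i<k k<b) b<j
      with nonOverlapping m m′ (λ eq → <⇒≢ k<b (cong (proj₁ ∘ proj₂) eq))
    ... | inj₁ (_ , (_ , b≤k) , _) = contradiction b≤k (<⇒≱ k<b)
    ... | inj₂ (inj₁ ((k≤a , _) , _)) = a , c , m′ , k≤a , c≤j
    ... | inj₂ (inj₂ (_ , inj₁ j≤b , _)) = contradiction j≤b (<⇒≱ b<j)
    ... | inj₂ (inj₂ (_ , inj₂ b≤i , _)) = contradiction b≤i (<⇒≱ (<-trans i<k k<b))

  -- The bound `j ≤ i + n` makes the recursion structural in `n`. Only the inclusion of the tree's
  -- triangles in `M` is recorded; the converse follows in `decode` from uniqueness of middle
  -- vertices.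
  toTree : ∀ n {i j} → i < j → j ≤ i + n → Covered i j →
    ∃ λ t → end t i ≡ j × (∀ {x} → x ∈ triangles t i → M x)
  toTree n {i} {j} i<j j≤i+n cov with m≤n⇒m<n∨m≡n i<j
  ... | inj₂ refl = leaf , refl , λ ()
  toTree zero {i} i<j j≤i+0 cov | inj₁ _ = contradiction (subst (_ ≤_) (+-identityʳ i) j≤i+0) (<⇒≱ i<j)
  toTree (suc n) {i} {j} i<j j≤i+n cov | inj₁ 1+i<j
    with k , m ← findRoot cov 1+i<j
    with i<k , k<j ← increasing m
    with cov-l , cov-r ← split m cov
    with l , refl , l⊆M ← toTree n i<k (s≤s⁻¹ (≤-trans k<j (≤-trans j≤i+n (≤-reflexive (+-suc i n))))) cov-l
    with r , refl , r⊆M ← toTree n k<j (≤-trans j≤i+n (≤-trans (≤-reflexive (+-suc i n)) (+-monoˡ-≤ n i<k))) cov-r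
    = node l r , refl , λ x∈ → ⊆M (position l r i x∈)
    where
    ⊆M : ∀ {x} → Position l r i x → M x
    ⊆M (root refl) = m
    ⊆M (left x∈)   = l⊆M x∈
    ⊆M (right x∈)  = r⊆M x∈

-- Lists without repetition and counting

module _ {A : Set} where

  -- The pigeonhole principle: the head of `xs` is cut out of `ys`, and the tail still embeds in
  -- what remains.
  unique-⊆⇒length≤ : ∀ {xs ys : List A} → Unique xs → (∀ {x} → x ∈ xs → x ∈ ys) → length xs ≤ length ys
  unique-⊆⇒length≤ [] _ = z≤n
  unique-⊆⇒length≤ {x ∷ xs} (x∉xs ∷ uxs) xs⊆ys with us , vs , refl ← ∈-∃++ (xs⊆ys (here refl)) =
    subst (suc (length xs) ≤_) length-insert (s≤s (unique-⊆⇒length≤ uxs xs⊆us++vs))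
    where
    xs⊆us++vs : ∀ {z} → z ∈ xs → z ∈ us ++ vs
    xs⊆us++vs z∈ with ∈-++⁻ us (xs⊆ys (there z∈))
    ... | inj₁ z∈us         = ∈-++⁺ˡ z∈us
    ... | inj₂ (here refl)  = contradiction refl (All.lookup x∉xs z∈)
    ... | inj₂ (there z∈vs) = ∈-++⁺ʳ us z∈vs
    length-insert : suc (length (us ++ vs)) ≡ length (us ++ x ∷ vs)
    length-insert = trans (cong suc (length-++ us)) (sym (trans (length-++ us) (+-suc (length us) (length vs))))

  -- An element of `ys` missing from `xs` could be put in front of `xs`, contradicting the
  -- pigeonhole principle. The conclusion is doubly negated because equality on `A` is not assumed
  -- decidable.
  unique-⊆-saturated : ∀ {xs ys : List A} → Unique xs → (∀ {x} → x ∈ xs → x ∈ ys) →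
    length ys ≤ length xs → ∀ {y} → y ∈ ys → ¬ (y ∉ xs)
  unique-⊆-saturated {xs} {ys} uxs xs⊆ys ys≤xs {y} y∈ys y∉xs =
    <⇒≱ (unique-⊆⇒length≤ (All.tabulate (λ z∈ y≡z → y∉xs (subst (_∈ xs) (sym y≡z) z∈)) ∷ uxs) y∷xs⊆ys) ys≤xs
    where
    y∷xs⊆ys : ∀ {z} → z ∈ y ∷ xs → z ∈ ys
    y∷xs⊆ys (here refl) = y∈ys
    y∷xs⊆ys (there z∈)  = xs⊆ys z∈

  -- Injectivity is asked only on the list, because `middle` and `encode` are injective only on
  -- suitable lists.
  unique-map-on : ∀ {B : Set} {f : A → B} {xs} → (∀ {x y} → x ∈ xs → y ∈ xs → f x ≡ f y → x ≡ y) →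
    Unique xs → Unique (map f xs)
  unique-map-on inj [] = []
  unique-map-on {f = f} {x ∷ xs} inj (x∉ ∷ uxs) =
    All.tabulate (λ z∈ eq → let y , y∈ , z≡fy = ∈-map⁻ f z∈ in
      All.lookup x∉ y∈ (inj (here refl) (there y∈) (trans eq z≡fy)))
    ∷ unique-map-on (λ x∈ y∈ → inj (there x∈) (there y∈)) uxs

  unique-concatMap : ∀ {B : Set} {f : A → List B} {xs} → Unique xs → (∀ x → Unique (f x)) →
    (∀ {x y z} → z ∈ f x → z ∈ f y → x ≡ y) → Unique (concatMap f xs)
  unique-concatMap [] uf inj = []
  unique-concatMap {f = f} {x ∷ xs} (x∉ ∷ uxs) uf inj =
    Unique.++⁺ (uf x) (unique-concatMap uxs uf inj) λ (z∈ , z∈′) →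
      let y , y∈ , z∈fy = find (∈-concatMap⁻ f z∈′) in All.lookup x∉ y∈ (inj z∈ z∈fy)

  filterᵇ : (A → Bool) → List A → List A
  filterᵇ p = filter (λ x → p x Bool.≟ true)

  countᵇ≡length-filterᵇ : ∀ p xs → countᵇ p xs ≡ length (filterᵇ p xs)
  countᵇ≡length-filterᵇ p [] = refl
  countᵇ≡length-filterᵇ p (x ∷ xs) with p x
  ... | true  = cong suc (countᵇ≡length-filterᵇ p xs)
  ... | false = countᵇ≡length-filterᵇ p xs

  countᵇ-true : ∀ (xs : List A) → countᵇ (λ _ → true) xs ≡ length xs
  countᵇ-true []       = refl
  countᵇ-true (x ∷ xs) = cong suc (countᵇ-true xs)

-- Both counts are lengths of repetition-free filtered lists; the image of the first and the second
-- contain each other.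
countᵇ-transfer : ∀ {A B : Set} {p : A → Bool} {q : B → Bool} {f : A → B} {xs ys} →
  Injective _≡_ _≡_ f → Unique xs → Unique ys →
  (∀ {x} → x ∈ xs → p x ≡ true → f x ∈ ys × q (f x) ≡ true) →
  (∀ {y} → y ∈ ys → q y ≡ true → ∃ λ x → x ∈ xs × p x ≡ true × y ≡ f x) →
  countᵇ p xs ≡ countᵇ q ys
countᵇ-transfer {p = p} {q} {f} {xs} {ys} f-inj uxs uys to from = begin
  countᵇ p xs                       ≡⟨ countᵇ≡length-filterᵇ p xs ⟩
  length (filterᵇ p xs)             ≡⟨ length-map f (filterᵇ p xs) ⟨
  length (map f (filterᵇ p xs))     ≡⟨ ≤-antisym (unique-⊆⇒length≤ ufxs ⊆ys) (unique-⊆⇒length≤ ufys ⊆xs) ⟩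
  length (filterᵇ q ys)             ≡⟨ countᵇ≡length-filterᵇ q ys ⟨
  countᵇ q ys                       ∎
  where
  open ≡-Reasoning
  p? = λ x → p x Bool.≟ true
  q? = λ y → q y Bool.≟ true
  ufxs : Unique (map f (filterᵇ p xs))
  ufxs = Unique.map⁺ f-inj (Unique.filter⁺ p? uxs)
  ufys : Unique (filterᵇ q ys)
  ufys = Unique.filter⁺ q? uys
  ⊆ys : ∀ {y} → y ∈ map f (filterᵇ p xs) → y ∈ filterᵇ q ys
  ⊆ys y∈ with x , x∈ , refl ← ∈-map⁻ f y∈ =
    let x∈xs , px = ∈-filter⁻ p? x∈
        fx∈ , qfx = to x∈xs px
    in ∈-filter⁺ q? fx∈ qfx
  ⊆xs : ∀ {y} → y ∈ filterᵇ q ys → y ∈ map f (filterᵇ p xs)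
  ⊆xs y∈ with y∈ys , qy ← ∈-filter⁻ q? {xs = ys} y∈
    with x , x∈ , px , refl ← from y∈ys qy = ∈-map⁺ f (∈-filter⁺ p? x∈ px)

-- Triangle sets on Fin N

allTris-complete : ∀ {N} (τ : Tri N) → τ ∈ allTris N
allTris-complete {N} (a , b , c) =
  ∈-concatMap⁺ (λ a → concatMap (λ b → map (λ c → (a , b , c)) (allFinL N)) (allFinL N))
    (lose (∈-allFin a)
      (∈-concatMap⁺ (λ b → map (λ c → (a , b , c)) (allFinL N))
        (lose (∈-allFin b) (∈-map⁺ (λ c → (a , b , c)) (∈-allFin c)))))

allTris-unique : ∀ N → Unique (allTris N)
allTris-unique N = unique-concatMap (Unique.allFin⁺ N)
  (λ a → unique-concatMap (Unique.allFin⁺ N)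
    (λ b → Unique.map⁺ (cong (proj₂ ∘ proj₂)) (Unique.allFin⁺ N))
    (λ z∈ z∈′ → trans (sym (second a z∈)) (second a z∈′)))
  (λ z∈ z∈′ → trans (sym (first z∈)) (first z∈′))
  where
  second : ∀ a {b z} → z ∈ map (λ c → (a , b , c)) (allFinL N) → proj₁ (proj₂ z) ≡ b
  second a {b} z∈ with _ , _ , refl ← ∈-map⁻ (λ c → (a , b , c)) z∈ = refl
  first : ∀ {a z} → z ∈ concatMap (λ b → map (λ c → (a , b , c)) (allFinL N)) (allFinL N) → proj₁ z ≡ a
  first {a} z∈
    with b , z∈b ← satisfied (∈-concatMap⁻ (λ b → map (λ c → (a , b , c)) (allFinL N)) {xs = allFinL N} z∈)
    with _ , _ , refl ← ∈-map⁻ (λ c → (a , b , c)) z∈b = refl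

toTriSet : ∀ {N} → (Tri N → Bool) → TriSet N
toTriSet f = tabulate λ a → tabulate λ b → tabulate λ c → f (a , b , c)

memᵇ-toTriSet : ∀ {N} (f : Tri N → Bool) τ → memᵇ (toTriSet f) τ ≡ f τ
memᵇ-toTriSet f (a , b , c) = begin
  lookup (lookup (lookup (toTriSet f) a) b) c
    ≡⟨ cong (λ v → lookup (lookup v b) c) (lookup∘tabulate _ a) ⟩
  lookup (lookup (tabulate λ b → tabulate λ c → f (a , b , c)) b) c
    ≡⟨ cong (λ v → lookup v c) (lookup∘tabulate _ b) ⟩
  lookup (tabulate λ c → f (a , b , c)) c
    ≡⟨ lookup∘tabulate _ c ⟩
  f (a , b , c) ∎
  where open ≡-Reasoning

toTriSet-cong : ∀ {N} {f g : Tri N → Bool} → (∀ τ → f τ ≡ g τ) → toTriSet f ≡ toTriSet g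
toTriSet-cong f≗g = tabulate-cong λ a → tabulate-cong λ b → tabulate-cong λ c → f≗g (a , b , c)

toTriSet-memᵇ : ∀ {N} (S : TriSet N) → toTriSet (memᵇ S) ≡ S
toTriSet-memᵇ S = trans
  (tabulate-cong λ a → trans (tabulate-cong λ b → tabulate∘lookup _) (tabulate∘lookup _))
  (tabulate∘lookup S)

toNats : ∀ {N} → Tri N → Triple
toNats (a , b , c) = toℕ a , toℕ b , toℕ c

toNats-injective : ∀ {N} {τ τ′ : Tri N} → toNats τ ≡ toNats τ′ → τ ≡ τ′
toNats-injective eq = cong₂ _,_ (toℕ-injective (cong proj₁ eq))
  (cong₂ _,_ (toℕ-injective (cong (proj₁ ∘ proj₂) eq)) (toℕ-injective (cong (proj₂ ∘ proj₂) eq)))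

-- Encoding trees as triangle sets

open DecMembership _≟³_ using (_∈?_)
open DecMembership _≟_ using () renaming (_∈?_ to _∈ℕ?_)

-- Triangles with a vertex outside `Fin N` would be lost, so the results on size, fairness and
-- injectivity assume that `t` ends at the last vertex.
encode : ∀ N → Tree → TriSet N
encode N t = toTriSet λ τ → does (toNats τ ∈? triangles t 0)

∈-encode⁻ : ∀ {N} t {τ : Tri N} → τ ∈T encode N t → toNats τ ∈ triangles t 0
∈-encode⁻ t {τ} τ∈ with trans (sym (memᵇ-toTriSet _ τ)) τ∈
... | eq with yes x∈ ← toNats τ ∈? triangles t 0 = x∈

∈-encode⁺ : ∀ {N} t {τ : Tri N} → toNats τ ∈ triangles t 0 → τ ∈T encode N t
∈-encode⁺ t {τ} x∈ = trans (memᵇ-toTriSet _ τ) (dec-true (toNats τ ∈? triangles t 0) x∈)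

module _ (m : ℕ) where

  -- In this form `N ∸ 2` computes to `m`, and the modulus in `fromℕ` is visibly nonzero.
  private N = 2 + m

  -- Junk (reduction mod N) outside the range of toℕ.
  fromℕ : ℕ → Fin N
  fromℕ x = x mod N

  toℕ-fromℕ : ∀ {x} → x < N → toℕ (fromℕ x) ≡ x
  toℕ-fromℕ {x} x<N = trans (toℕ-fromℕ< (m%n<n x N)) (m<n⇒m%n≡m x<N)

  fromℕ-toℕ : ∀ a → fromℕ (toℕ a) ≡ a
  fromℕ-toℕ a = toℕ-injective (toℕ-fromℕ (toℕ<n a))

  fromNats : Triple → Tri N
  fromNats (a , b , c) = fromℕ a , fromℕ b , fromℕ c

  fromNats-toNats : ∀ τ → fromNats (toNats τ) ≡ τ
  fromNats-toNats (a , b , c) = cong₂ _,_ (fromℕ-toℕ a) (cong₂ _,_ (fromℕ-toℕ b) (fromℕ-toℕ c))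

  module _ (t : Tree) (end≡ : end t 0 ≡ suc m) where

    bounds : ∀ {a b c} → (a , b , c) ∈ triangles t 0 → a < N × b < N × c < N
    bounds x∈ =
      let (_ , a≤) , (_ , b≤) , (_ , c≤) = Inside⇒bounds (inside t 0 x∈)
          ≤⇒< = λ {u} (u≤ : u ≤ end t 0) → s≤s (≤-trans u≤ (≤-reflexive end≡))
      in ≤⇒< a≤ , ≤⇒< b≤ , ≤⇒< c≤

    toNats-fromNats : ∀ {x} → x ∈ triangles t 0 → toNats (fromNats x) ≡ x
    toNats-fromNats x∈ = let a< , b< , c< = bounds x∈ in
      cong₂ _,_ (toℕ-fromℕ a<) (cong₂ _,_ (toℕ-fromℕ b<) (toℕ-fromℕ c<))

    fromNats∈encode : ∀ {x} → x ∈ triangles t 0 → fromNats x ∈T encode N t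
    fromNats∈encode x∈ = ∈-encode⁺ t (subst (_∈ triangles t 0) (sym (toNats-fromNats x∈)) x∈)

    -- Counts over all triples of `Fin N` are carried to the list of triangles along `toNats`, with
    -- preimages given by `fromNats`. It serves for the size and for both colour counts.
    countᵇ-encode : ∀ (p : Tri N → Bool) (q : Triple → Bool) →
      (∀ τ → p τ ≡ true → τ ∈T encode N t × q (toNats τ) ≡ true) →
      (∀ τ → τ ∈T encode N t → q (toNats τ) ≡ true → p τ ≡ true) →
      countᵇ p (allTris N) ≡ countᵇ q (triangles t 0)
    countᵇ-encode p q to from = countᵇ-transfer toNats-injective (allTris-unique N) (triangles-unique t 0)
      (λ {τ} _ pτ → let τ∈ , qτ = to τ pτ in ∈-encode⁻ t τ∈ , qτ)
      (λ {x} x∈ qx → fromNats x , allTris-complete _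
        , from _ (fromNats∈encode x∈) (trans (cong q (toNats-fromNats x∈)) qx)
        , sym (toNats-fromNats x∈))

    size-encode : size (encode N t) ≡ m
    size-encode = begin
      size (encode N t)                         ≡⟨ countᵇ-encode (memᵇ (encode N t)) (λ _ → true) (λ _ τ∈ → τ∈ , refl) (λ _ τ∈ _ → τ∈) ⟩
      countᵇ (λ _ → true) (triangles t 0)       ≡⟨ countᵇ-true (triangles t 0) ⟩
      length (triangles t 0)                    ≡⟨ length-triangles t 0 ⟩
      evens t + odds t                          ≡⟨ suc-injective (trans (sym (end-size t 0)) end≡) ⟩
      m                                         ∎
      where open ≡-Reasoning

    encode-isTriangulation : IsTriangulation (encode N t)
    encode-isTriangulation = record
      { ordered  = λ τ τ∈ → let _ , a<b , b<c , _ = inside t 0 (∈-encode⁻ t τ∈) in a<b , b<c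
      ; disjoint = λ τ τ′ τ∈ τ′∈ τ≢τ′ →
          triangles-nonOverlapping t 0 (∈-encode⁻ t τ∈) (∈-encode⁻ t τ′∈) (τ≢τ′ ∘ toNats-injective)
      ; card     = size-encode
      }

    countᵇ-and : ∀ (f : Tri N → Bool) (g : Triple → Bool) → (∀ τ → f τ ≡ g (toNats τ)) →
      countᵇ (λ τ → and (memᵇ (encode N t) τ) (f τ)) (allTris N) ≡ countᵇ g (triangles t 0)
    countᵇ-and f g f≗g = countᵇ-encode _ g
      (λ τ pτ → let τ∈ , fτ = and-true pτ in τ∈ , trans (sym (f≗g τ)) fτ)
      (λ τ τ∈ gτ → true-and τ∈ (trans (f≗g τ) gτ))
      where
      and-true : ∀ {a b} → and a b ≡ true → a ≡ true × b ≡ true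
      and-true {true} eq = refl , eq
      true-and : ∀ {a b} → a ≡ true → b ≡ true → and a b ≡ true
      true-and refl eq = eq

    encode-fair⁺ : evens t ≡ odds t → Fair (encode N t)
    encode-fair⁺ eq = col , checkerboard , (begin
      blackCount (encode N t) col                       ≡⟨ countᵇ-and col (colour t 0 true) (λ _ → refl) ⟩
      countᵇ (colour t 0 true) (triangles t 0)          ≡⟨ evens≡odds⇒balanced t 0 eq ⟩
      countᵇ (not ∘ colour t 0 true) (triangles t 0)    ≡⟨ countᵇ-and (not ∘ col) (not ∘ colour t 0 true) (λ _ → refl) ⟨
      whiteCount (encode N t) col                       ∎)
      where
      open ≡-Reasoning
      col : Tri N → Bool
      col = colour t 0 true ∘ toNats
      on : ∀ {u : Fin N} τ → VertexOf u τ → On (toℕ u) (toNats τ)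
      on _ = Sum.map (cong toℕ) (Sum.map (cong toℕ) (cong toℕ))
      checkerboard : IsCheckerboard (encode N t) col
      checkerboard τ τ′ τ∈ τ′∈ τ≢τ′ (u , v , u≢v , uτ , vτ , uτ′ , vτ′) =
        colour-proper t 0 true (∈-encode⁻ t τ∈) (∈-encode⁻ t τ′∈) (τ≢τ′ ∘ toNats-injective)
          (toℕ u , toℕ v , u≢v ∘ toℕ-injective , on τ uτ , on τ vτ , on τ′ uτ′ , on τ′ vτ′)

    -- The given colouring is arbitrary, so it is pulled back along `fromNats` to a proper colouring
    -- of the tree's triangles. These lie in the range where `fromNats` inverts `toNats`.
    encode-fair⁻ : Fair (encode N t) → evens t ≡ odds t
    encode-fair⁻ (col , checkerboard , eq) = balanced⇒evens≡odds t 0 proper (begin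
      countᵇ (col ∘ fromNats) (triangles t 0)           ≡⟨ countᵇ-and col (col ∘ fromNats) (λ τ → cong col (sym (fromNats-toNats τ))) ⟨
      blackCount (encode N t) col                       ≡⟨ eq ⟩
      whiteCount (encode N t) col                       ≡⟨ countᵇ-and (not ∘ col) (not ∘ col ∘ fromNats) (λ τ → cong (not ∘ col) (sym (fromNats-toNats τ))) ⟩
      countᵇ (not ∘ col ∘ fromNats) (triangles t 0)     ∎)
      where
      open ≡-Reasoning
      vertex : ∀ {u} x → On u x → VertexOf (fromℕ u) (fromNats x)
      vertex _ = Sum.map (cong fromℕ) (Sum.map (cong fromℕ) (cong fromℕ))
      on-< : ∀ {u x} → x ∈ triangles t 0 → On u x → u < N
      on-< x∈ ux = s≤s (≤-trans (proj₂ (On⇒bounds _ (inside t 0 x∈) ux)) (≤-reflexive end≡))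
      proper : Proper (triangles t 0) (col ∘ fromNats)
      proper {x} {y} x∈ y∈ x≢y (u , v , u≢v , ux , vx , uy , vy) =
        checkerboard _ _ (fromNats∈encode x∈) (fromNats∈encode y∈)
          (λ fx≡fy → x≢y (trans (sym (toNats-fromNats x∈)) (trans (cong toNats fx≡fy) (toNats-fromNats y∈))))
          ( fromℕ u , fromℕ v
          , (λ fu≡fv → u≢v (trans (sym (toℕ-fromℕ (on-< x∈ ux))) (trans (cong toℕ fu≡fv) (toℕ-fromℕ (on-< x∈ vx)))))
          , vertex x ux , vertex x vx , vertex y uy , vertex y vy)

  encode-injective : ∀ t t′ → end t 0 ≡ suc m → end t′ 0 ≡ suc m → encode N t ≡ encode N t′ → t ≡ t′
  encode-injective t t′ eq eq′ enc≡ = triangles-injective t t′ 0 (trans eq (sym eq′)) λ {x} x∈ →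
    subst (_∈ triangles t′ 0) (toNats-fromNats t eq x∈)
      (∈-encode⁻ t′ (subst (fromNats x ∈T_) enc≡ (fromNats∈encode t eq x∈)))

  -- Recovering the tree of a triangulation

  module _ {S : TriSet N} (tri : IsTriangulation S) where

    open IsTriangulation tri

    Member : Triple → Set
    Member x = Σ (Tri N) λ τ → toNats τ ≡ x × τ ∈T S

    nonCrossing : NonCrossing Member
    nonCrossing = record
      { increasing     = λ { (τ , refl , τ∈) → ordered τ τ∈ }
      ; nonOverlapping = λ { (τ , refl , τ∈) (τ′ , refl , τ′∈) x≢y →
          disjoint τ τ′ τ∈ τ′∈ (x≢y ∘ cong toNats) }
      }

    open NonCrossing nonCrossing

    middle : Tri N → ℕ
    middle (_ , b , _) = toℕ b

    members : List (Tri N)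
    members = filterᵇ (memᵇ S) (allTris N)

    ∈-members⁻ : ∀ {τ} → τ ∈ members → τ ∈T S
    ∈-members⁻ τ∈ = proj₂ (∈-filter⁻ (λ τ → memᵇ S τ Bool.≟ true) {xs = allTris N} τ∈)

    middle-injective : ∀ {τ τ′} → τ ∈ members → τ′ ∈ members → middle τ ≡ middle τ′ → τ ≡ τ′
    middle-injective {τ} {τ′@(a′ , _ , c′)} τ∈ τ′∈ eq = toNats-injective (trans
      (middle-unique (τ , refl , ∈-members⁻ τ∈)
        (τ′ , cong (λ b → (toℕ a′ , b , toℕ c′)) (sym eq) , ∈-members⁻ τ′∈))
      (cong (λ b → (toℕ a′ , b , toℕ c′)) eq))

    -- From a < b < c ≤ m + 1, exactly the `m` candidates 1, ..., m remain.
    middle∈ : ∀ {b} → b ∈ map middle members → b ∈ map suc (upTo m)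
    middle∈ b∈ with (a , b , c) , τ∈ , refl ← ∈-map⁻ middle b∈
      with a<b , b<c ← ordered _ (∈-members⁻ τ∈) = inner a<b b<c
      where
      inner : ∀ {b} → toℕ a < b → b < toℕ c → b ∈ map suc (upTo m)
      inner {suc b} _ b<c = ∈-map⁺ suc (∈-upTo⁺ (s≤s⁻¹ (≤-trans b<c (s≤s⁻¹ (toℕ<n c)))))

    length-members : length members ≡ m
    length-members = trans (sym (countᵇ≡length-filterᵇ (memᵇ S) (allTris N))) card

    length-middles : length (map suc (upTo m)) ≡ length (map middle members)
    length-middles = trans (length-map suc (upTo m)) (trans (length-upTo m)
      (sym (trans (length-map middle members) length-members)))

    -- Triangles are determined by their middle vertices, so m of them use up all m candidates.
    covered : Covered 0 (suc m)
    covered (suc b) _ 1+b<1+m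
      with (a , b′ , c) , τ∈ , eq ← ∈-map⁻ middle (decidable-stable (suc b ∈ℕ? map middle members)
        (unique-⊆-saturated (unique-map-on middle-injective (Unique.filter⁺ (λ τ → memᵇ S τ Bool.≟ true) (allTris-unique N))) middle∈
          (≤-reflexive length-middles) (∈-map⁺ suc (∈-upTo⁺ (s≤s⁻¹ 1+b<1+m)))))
      = toℕ a , toℕ c , ((a , b′ , c) , cong (λ b → (toℕ a , b , toℕ c)) (sym eq) , ∈-members⁻ τ∈)
      , z≤n , s≤s⁻¹ (toℕ<n c)

    -- `toTree` gives one inclusion. Conversely, the middle vertex of a member of `S` is also the
    -- middle vertex of a triangle of the tree, and `middle-unique` identifies the two.
    decode : ∃ λ t → end t 0 ≡ suc m × S ≡ encode N t
    decode with t , end≡ , ⊆S ← toTree (suc m) (s≤s z≤n) ≤-refl covered =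
      t , end≡ , trans (sym (toTriSet-memᵇ S)) (toTriSet-cong agree)
      where
      member⇒∈ : ∀ {x} → Member x → x ∈ triangles t 0
      member⇒∈ {a , b , c} M@((_ , _ , c′) , refl , _)
        with a<b , b<c ← increasing M
        with a′ , c″ , x∈ ← triangles-middle t 0 b (≤-<-trans z≤n a<b)
          (subst (b <_) (sym end≡) (<-≤-trans b<c (s≤s⁻¹ (toℕ<n c′))))
        = subst (_∈ triangles t 0) (middle-unique (⊆S x∈) M) x∈
      agree : ∀ τ → memᵇ S τ ≡ does (toNats τ ∈? triangles t 0)
      agree τ with toNats τ ∈? triangles t 0
      ... | yes x∈ with τ′ , eq , τ′∈ ← ⊆S x∈ with refl ← toNats-injective {τ = τ′} {τ} eq = τ′∈
      ... | no x∉ with memᵇ S τ in eq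
      ...   | true  = contradiction (member⇒∈ (τ , refl , eq)) x∉
      ...   | false = refl

-- The list of fair triangulations

FairTriangulations : ℕ → ℕ → Set
FairTriangulations n N = Σ (List (TriSet N)) λ L →
  Unique L ×
  ((S : TriSet N) → (S ∈ L) ⇔ (IsTriangulation S × Fair S)) ×
  length L ≡ (((2 * n) C n) * ((2 * n) C n)) / suc n

fairTriangulations : ∀ n → FairTriangulations n (2 + 2 * n)
fairTriangulations n =
  map (encode N) (fairTrees n) ,
  unique-map-on (λ t∈ t′∈ → encode-injective (2 * n) _ _ (end-fair t∈) (end-fair t′∈)) (fairTrees-unique n) ,
  (λ S → mk⇔ sound complete) ,
  trans (length-map (encode N) (fairTrees n)) (length-fairTrees n)
  where
  N = 2 + 2 * n
  e+e≡2*e : ∀ e → e + e ≡ 2 * e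
  e+e≡2*e e = cong (e +_) (sym (+-identityʳ e))
  end-fair : ∀ {t} → t ∈ fairTrees n → end t 0 ≡ suc (2 * n)
  end-fair {t} t∈ with evens≡ , odds≡ ← fairTrees-sound n t∈ =
    trans (end-size t 0) (cong suc (trans (cong₂ _+_ evens≡ odds≡) (e+e≡2*e n)))
  sound : ∀ {S} → S ∈ map (encode N) (fairTrees n) → IsTriangulation S × Fair S
  sound S∈ with t , t∈ , refl ← ∈-map⁻ (encode N) S∈ with evens≡ , odds≡ ← fairTrees-sound n t∈ =
    encode-isTriangulation (2 * n) t (end-fair t∈) ,
    encode-fair⁺ (2 * n) t (end-fair t∈) (trans evens≡ (sym odds≡))
  complete : ∀ {S} → IsTriangulation S × Fair S → S ∈ map (encode N) (fairTrees n)
  complete (tri , fair) with t , end≡ , refl ← decode (2 * n) tri =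
    ∈-map⁺ (encode N) (fairTrees-complete n evens≡n (trans (sym evens≡odds) evens≡n))
    where
    evens≡odds : evens t ≡ odds t
    evens≡odds = encode-fair⁻ (2 * n) t end≡ fair
    evens≡n : evens t ≡ n
    -- By `end-size` the two counts add up to `2 * n`, so being equal they are both `n`.
    evens≡n = *-cancelˡ-≡ _ _ 2 (trans (sym (e+e≡2*e (evens t)))
      (trans (cong (evens t +_) evens≡odds) (suc-injective (trans (sym (end-size t 0)) end≡))))

theorem1p1 : (n : ℕ) →
    Σ (List (TriSet (2 * n + 2))) λ L →
    Unique L ×
    ((S : TriSet (2 * n + 2)) → (S ∈ L) ⇔ (IsTriangulation S × Fair S)) ×
    length L ≡ (((2 * n) C n) * ((2 * n) C n)) / suc n
-- `2 * n + 2` does not compute to a successor, so the construction is carried out for `2 + 2 * n`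
-- and transported.
theorem1p1 n = subst (FairTriangulations n) (+-comm 2 (2 * n)) (fairTriangulations n)
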